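{- Let $\mathcal{F}=\mathcal{B}(K_3)$. Then, as $k\to\infty$, $$\frac{k}{2}-o(k)\;\le\; R_3(\mathcal{F},k)\;\le\;\frac{3k}{4}+o(k).$$
   Context: For a graph $G$, a hypergraph $H$ is a Berge-$G$ hypergraph if there are an injective map $\phi:V(G)\to V(H)$ and pairwise distinct hyperedges $e_{xy}\in E(H)$, one for each $xy\in E(G)$, with $\phi(x),\phi(y)\in e_{xy}$. $\mathcal{B}(G)$ denotes the family of all Berge-$G$ hypergraphs. $K_n^r$ denotes the complete $r$-uniform hypergraph on $n$ vertices. For a family $\mathcal{H}$ of $r$-uniform hypergraphs and integers $k\ge 2$, $r\ge 2$, the Ramsey number $R_r(\mathcal{H},k)$ is the smallest integer $n$ such that every coloring of the hyperedges of $K_n^r$ with $k$ colors contains a monochromatic subhypergraph belonging to $\mathcal{H}$. -}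

module Defs where

open import Data.Bool using (Bool; T)
open import Data.Fin using (Fin)
open import Data.Fin.Subset using (Subset; _∈_; _⊆_; ⊤; ∣_∣)
open import Data.Fin.Subset.Properties using (⊆-max)
open import Data.Integer using (+_)
open import Data.Nat as ℕ using (ℕ; _≡ᵇ_)
open import Data.Nat.Properties using (≡ᵇ⇒≡)
open import Data.Product using (Σ-syntax; ∃-syntax; _×_; _,_; proj₁)
open import Data.Rational as ℚ using (ℚ; 0ℚ; _/_)
open import Function.Definitions using (Injective)
open import Relation.Binary.PropositionalEquality using (_≡_)

-- A finite hypergraph whose vertex set is a subset of Fin n.  The edge set is
-- Bool-valued, so each edge is present at most once (no multi-edges).
record Hypergraph (n : ℕ) : Set where
  field
    V    : Subset n
    E    : Subset n → Bool
    E⊆V  : ∀ p → T (E p) → p ⊆ V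

  Vertex : Set
  Vertex = Σ[ x ∈ Fin n ] x ∈ V

  Edge : Set
  Edge = Σ[ p ∈ Subset n ] T (E p)

open Hypergraph public

Uniform : ∀ {n} → ℕ → Hypergraph n → Set
Uniform r H = ∀ p → T (E H p) → ∣ p ∣ ≡ r

-- A simple graph is a 2-uniform hypergraph: its edges are unordered pairs.
Graph : ℕ → Set
Graph n = Σ[ G ∈ Hypergraph n ] Uniform 2 G

Complete : (r n : ℕ) → Hypergraph n
Complete r n = record
  { V   = ⊤
  ; E   = λ p → ∣ p ∣ ≡ᵇ r
  ; E⊆V = λ p _ → ⊆-max p
  }

K₃ : Graph 3
K₃ = Complete 2 3 , λ p → ≡ᵇ⇒≡ ∣ p ∣ 2

Family : Set₁
Family = ∀ {n} → Hypergraph n → Set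

-- H may have vertices and edges beyond those used by φ and e.
Berge : ∀ {m} → Graph m → Family
Berge (G , _) H =
  Σ[ φ ∈ (Vertex G → Vertex H) ]
  Σ[ e ∈ (Edge G → Edge H) ]
    Injective _≡_ _≡_ φ
  × Injective _≡_ _≡_ e
  × (∀ (d : Edge G) (x : Vertex G) →
       proj₁ x ∈ proj₁ d → proj₁ (φ x) ∈ proj₁ (e d))

_⊑_ : ∀ {n} → Hypergraph n → Hypergraph n → Set
H ⊑ H′ = V H ⊆ V H′ × (∀ p → T (E H p) → T (E H′ p))

include : ∀ {n} {H H′ : Hypergraph n} → H ⊑ H′ → Edge H → Edge H′
include (_ , E⊑) (p , p∈E) = p , E⊑ p p∈E

Colouring : ∀ {n} → Hypergraph n → ℕ → Set
Colouring H k = Edge H → Fin k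

Monochromatic : ∀ {n k} {H H′ : Hypergraph n} → Colouring H′ k → H ⊑ H′ → Set
Monochromatic {H = H} {H′} χ H⊑H′ =
  ∃[ c ] ((d : Edge H) → χ (include {H = H} {H′} H⊑H′ d) ≡ c)

Arrows : (r : ℕ) → Family → (k n : ℕ) → Set
Arrows r ℋ k n =
  (χ : Colouring (Complete r n) k) →
  Σ[ H ∈ Hypergraph n ]
  Σ[ H⊑K ∈ H ⊑ Complete r n ]
    (Monochromatic {H = H} {Complete r n} χ H⊑K × ℋ H)

IsRamseyNumber : (r : ℕ) → Family → (k n : ℕ) → Set
IsRamseyNumber r ℋ k n =
  Arrows r ℋ k n × (∀ m → Arrows r ℋ k m → n ℕ.≤ m)

-- f(k) = o(k) as k → ∞.
LittleO : (ℕ → ℚ) → Set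
LittleO f =
  ∀ (ε : ℚ) → 0ℚ ℚ.< ε →
  ∃[ N ] (∀ k → N ℕ.≤ k → ℚ.∣ f k ∣ ℚ.≤ ε ℚ.* (+ k / 1))

module Submission where

-- Upper bound.  Call a pair light if exactly one edge of a colour class contains it.  In a
-- Berge-triangle-free class every edge has at least two light pairs, and two light pairs {x,w},
-- {y,w} over a third light pair {x,y} force w to be the third vertex of the edge on {x,y}.  The
-- light graph is therefore triangle-free up to one common neighbour per pair, so Mantel's argument
-- gives it about n²/4 edges at most and the class n²/8.  Comparing with the n³/6 triples yields
-- n ≤ 3k/4 + O(1).
--
-- Lower bound.  Halve the vertex set into A and B.  A triple with two vertices in A and one in B is
-- coloured by a proper edge colouring of the pair in A; such a class, a matching of A joined to
-- vertices of B, has no Berge triangle.  Triples with two vertices in B are treated likewise with new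
-- colours, and those inside A or inside B recursively with common colours.  In total n + n/2 + … ≤ 2n
-- colours suffice, up to a logarithmic term.

open import Defs
open import Data.Bool using (true; false; T; T?)
open import Data.Bool.Properties using (T-irrelevant) renaming (_≟_ to _≟ᵇ_)
open import Data.Empty using (⊥; ⊥-elim)
open import Data.Fin as Fin using (Fin; zero; suc; toℕ; splitAt; join; inject≤)
open import Data.Fin.Properties as Fin using (any?; all?; ¬∀⟶∃¬)
open import Data.Fin.Subset as Sub using (Subset; _∈_; _∉_; _⊆_; ∣_∣; _∪_; ⁅_⁆; ⊤)
open import Data.Fin.Subset.Properties
open import Data.Integer as ℤ using (+_; -[1+_])
import Data.Integer.Properties as ℤ
open import Data.Nat as ℕ using
  (ℕ; zero; suc; s≤s; z≤n; _+_; _*_; _∸_; _^_; _%_; _≤_; _<_; NonZero; ⌊_/2⌋; ⌈_/2⌉)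
open import Data.Nat.DivMod using
  (_mod_; m≡m%n+[m/n]*n; m%n<n; m/n*n≤m; m<n⇒m%n≡m; [m+n]%n≡m%n; %-distribˡ-+)
import Data.Nat.Properties as ℕ
open import Data.Nat.Solver using (module +-*-Solver)
open import Data.Product using (Σ-syntax; ∃-syntax; _×_; _,_; proj₁; proj₂; swap)
open import Data.Rational as ℚ using (ℚ; 0ℚ; mkℚ; toℚᵘ; _/_)
import Data.Rational.Properties as ℚ
open import Data.Rational.Unnormalised as ℚᵘ using (mkℚᵘ)
import Data.Rational.Unnormalised.Properties as ℚᵘ
open import Data.Sum as Sum using (_⊎_; inj₁; inj₂; [_,_]′)
open import Data.Sum.Properties using (swap-involutive; inj₂-injective)
open import Data.Vec using ([]; _∷_; _++_; here; there; take; drop)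
open import Data.Vec.Properties using (≡-dec; take++drop≡id)
open import Data.Vec.Properties.WithK using ([]=-irrelevant)
open import Function using (_∘_; id)
open import Function.Definitions using (Injective)
open import Relation.Binary.PropositionalEquality
open import Relation.Nullary using (¬_; Dec; yes; no; contradiction)
open import Relation.Nullary.Decidable using
  (map′; _×-dec_; _→-dec_; ¬?; ⌊_⌋; toWitness; fromWitness; decidable-stable)
open import Relation.Unary using (Decidable)
open import Algebra.Properties.Semiring.Sum ℕ.+-*-semiring using
  (sum; sum-syntax; sum-cong-≗; ∑-distrib-+; ∑-comm; *-distribˡ-sum; *-distribʳ-sum)
open +-*-Solver using (solve; con; _:=_; _:+_; _:*_)

-- Berge triangles and decidability of the arrow relation

_≟ˢ_ : ∀ {n} (p q : Subset n) → Dec (p ≡ q)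
_≟ˢ_ = ≡-dec _≟ᵇ_

-- Incidence is a parameter because the lower bound also needs vertices in `Fin a ⊎ Fin b` and edges
-- that are pairs of subsets. The edges `p`, `q`, `r` carry the sides `xy`, `yz`, `xz`.
record BergeTriangle {V W : Set} (_∈_ : V → W → Set) (P : W → Set) : Set where
  constructor triangle
  field
    {x y z} : V
    {p q r} : W
    x≢y : x ≢ y
    y≢z : y ≢ z
    x≢z : x ≢ z
    p≢q : p ≢ q
    q≢r : q ≢ r
    p≢r : p ≢ r
    Pp  : P p
    Pq  : P q
    Pr  : P r
    x∈p : x ∈ p
    y∈p : y ∈ p
    y∈q : y ∈ q
    z∈q : z ∈ q
    x∈r : x ∈ r
    z∈r : z ∈ r

mapTriangle : ∀ {V W V′ W′ : Set} {_∈_ : V → W → Set} {_∈′_ : V′ → W′ → Set} {P P′} →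
              (φ : V → V′) → Injective _≡_ _≡_ φ → (ψ : W → W′) → Injective _≡_ _≡_ ψ →
              (∀ {v w} → v ∈ w → φ v ∈′ ψ w) → (∀ {w} → P w → P′ (ψ w)) →
              BergeTriangle _∈_ P → BergeTriangle _∈′_ P′
mapTriangle φ φ-inj ψ ψ-inj ∈⇒∈′ P⇒P′ t = record
  { x≢y = x≢y ∘ φ-inj ; y≢z = y≢z ∘ φ-inj ; x≢z = x≢z ∘ φ-inj
  ; p≢q = p≢q ∘ ψ-inj ; q≢r = q≢r ∘ ψ-inj ; p≢r = p≢r ∘ ψ-inj
  ; Pp = P⇒P′ Pp ; Pq = P⇒P′ Pq ; Pr = P⇒P′ Pr
  ; x∈p = ∈⇒∈′ x∈p ; y∈p = ∈⇒∈′ y∈p ; y∈q = ∈⇒∈′ y∈q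
  ; z∈q = ∈⇒∈′ z∈q ; x∈r = ∈⇒∈′ x∈r ; z∈r = ∈⇒∈′ z∈r }
  where open BergeTriangle t

Triangle : ∀ {n} → (Subset n → Set) → Set
Triangle = BergeTriangle _∈_

triangle? : ∀ {n} {P : Subset n → Set} → Decidable P → Dec (Triangle P)
triangle? P? = map′
  (λ (_ , _ , _ , _ , _ , _ , a , b , c , d , e , f , g , h , i , j , k , l , m , n , o) →
     triangle a b c d e f g h i j k l m n o)
  (λ (triangle a b c d e f g h i j k l m n o) →
     _ , _ , _ , _ , _ , _ , a , b , c , d , e , f , g , h , i , j , k , l , m , n , o)
  (any? λ x → any? λ y → any? λ z →
   anySubset? λ p → anySubset? λ q → anySubset? λ r →
     ¬? (x Fin.≟ y) ×-dec ¬? (y Fin.≟ z) ×-dec ¬? (x Fin.≟ z)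
     ×-dec ¬? (p ≟ˢ q) ×-dec ¬? (q ≟ˢ r) ×-dec ¬? (p ≟ˢ r)
     ×-dec P? p ×-dec P? q ×-dec P? r
     ×-dec x ∈? p ×-dec y ∈? p ×-dec y ∈? q ×-dec z ∈? q ×-dec x ∈? r ×-dec z ∈? r)

-- Colourings are taken on all subsets, so that no proofs occur in their domain; only the values on
-- triples count.
ColourClass : ∀ {n} {C : Set} → (Subset n → C) → C → Subset n → Set
ColourClass f c p = ∣ p ∣ ≡ 3 × f p ≡ c

MonoTriangle : ∀ {n} {C : Set} → (Subset n → C) → Set
MonoTriangle f = ∃[ c ] Triangle (ColourClass f c)

colourClass? : ∀ {n k} (f : Subset n → Fin k) c → Decidable (ColourClass f c)
colourClass? f c p = (∣ p ∣ ℕ.≟ 3) ×-dec (f p Fin.≟ c)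

monoTriangle? : ∀ {n k} (f : Subset n → Fin k) → Dec (MonoTriangle f)
monoTriangle? f = any? λ c → triangle? (colourClass? f c)

monoTriangle-ext : ∀ {n} {C : Set} {f g : Subset n → C} → f ≗ g → MonoTriangle f → MonoTriangle g
monoTriangle-ext f≗g (c , t) =
  c , mapTriangle id id id id id (λ {p} (∣p∣≡3 , fp≡c) → ∣p∣≡3 , trans (sym (f≗g p)) fp≡c) t

-- Induction on `n`: membership of the first point splits a function on subsets of `Fin (suc n)`
-- into two functions on subsets of `Fin n`. Gluing these restores the function only pointwise,
-- hence the closure condition on `P`.
allColourings? : ∀ {n k} (P : (Subset n → Fin k) → Set) →
                 (∀ {f g} → f ≗ g → P f → P g) → Decidable P → Dec (∀ f → P f)
allColourings? {zero} P ext P? =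
  map′ (λ all f → ext (λ { [] → refl }) (all (f []))) (λ all c → all (λ _ → c))
       (all? λ c → P? (λ _ → c))
allColourings? {suc n} {k} P ext P? =
  map′ (λ all f → ext (λ { (true ∷ _) → refl ; (false ∷ _) → refl })
                      (all (f ∘ (true ∷_)) (f ∘ (false ∷_))))
       (λ all f g → all (glue f g))
       (allColourings? _ (λ f≗f′ all g → ext (glue-cong f≗f′ (λ _ → refl)) (all g)) λ f →
        allColourings? _ (λ g≗g′ → ext (glue-cong (λ _ → refl) g≗g′)) λ g → P? (glue f g))
  where
  glue : (f g : Subset n → Fin k) → Subset (suc n) → Fin k
  glue f g (true  ∷ p) = f p
  glue f g (false ∷ p) = g p

  glue-cong : ∀ {f f′ g g′} → f ≗ f′ → g ≗ g′ → glue f g ≗ glue f′ g′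
  glue-cong f≗f′ g≗g′ (true  ∷ p) = f≗f′ p
  glue-cong f≗f′ g≗g′ (false ∷ p) = g≗g′ p

-- The value `zero` off the triples is a default that no colour class sees; `suc k` guarantees that
-- such a colour exists.
extend : ∀ {n k} → Colouring (Complete 3 n) (suc k) → Subset n → Fin (suc k)
extend χ p with T? (∣ p ∣ ℕ.≡ᵇ 3)
... | yes t = χ (p , t)
... | no _  = zero

extend-≡ : ∀ {n k} (χ : Colouring (Complete 3 n) (suc k)) p t → extend χ p ≡ χ (p , t)
extend-≡ χ p t with T? (∣ p ∣ ℕ.≡ᵇ 3)
... | yes t′ = cong (λ t → χ (p , t)) (T-irrelevant t′ t)
... | no ¬t  = contradiction t ¬t

-- The whole colour class `c` is taken as the monochromatic hypergraph, since a Berge copy may have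
-- further edges.
monoTriangle⇒arrows : ∀ {n k} → (∀ (f : Subset n → Fin (suc k)) → MonoTriangle f) →
                      Arrows 3 (Berge K₃) (suc k) n
monoTriangle⇒arrows {n} all χ with all (extend χ)
... | c , triangle {x} {y} {z} {p} {q} {r} x≢y y≢z x≢z p≢q q≢r p≢r Pp Pq Pr x∈p y∈p y∈q z∈q x∈r z∈r
  = H , H⊑K , (c , mono) , φ , e , φ-inj , e-inj , incident
  where
  H : Hypergraph n
  H = record { V = ⊤ ; E = λ p → ⌊ colourClass? (extend χ) c p ⌋ ; E⊆V = λ _ _ _ → ∈⊤ }

  H⊑K : H ⊑ Complete 3 n
  H⊑K = id , λ p → ℕ.≡⇒≡ᵇ ∣ p ∣ 3 ∘ proj₁ ∘ toWitness

  mono : (d : Edge H) → χ (include {H = H} {Complete 3 n} H⊑K d) ≡ c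
  mono (p , p∈E) = trans (sym (extend-≡ χ p _)) (proj₂ (toWitness p∈E))

  φ : Vertex (proj₁ K₃) → Vertex H
  φ (zero , _)          = x , ∈⊤
  φ (suc zero , _)      = y , ∈⊤
  φ (suc (suc zero) , _) = z , ∈⊤

  φ-inj : ∀ {u v} → φ u ≡ φ v → u ≡ v
  φ-inj {zero , here} {zero , here} _ = refl
  φ-inj {zero , _} {suc zero , _} eq = contradiction (cong proj₁ eq) x≢y
  φ-inj {zero , _} {suc (suc zero) , _} eq = contradiction (cong proj₁ eq) x≢z
  φ-inj {suc zero , _} {zero , _} eq = contradiction (sym (cong proj₁ eq)) x≢y
  φ-inj {suc zero , there here} {suc zero , there here} _ = refl
  φ-inj {suc zero , _} {suc (suc zero) , _} eq = contradiction (cong proj₁ eq) y≢z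
  φ-inj {suc (suc zero) , _} {zero , _} eq = contradiction (sym (cong proj₁ eq)) x≢z
  φ-inj {suc (suc zero) , _} {suc zero , _} eq = contradiction (sym (cong proj₁ eq)) y≢z
  φ-inj {suc (suc zero) , there (there here)} {suc (suc zero) , there (there here)} _ = refl

  e : Edge (proj₁ K₃) → Edge H
  e (true  ∷ true  ∷ false ∷ [] , _) = p , fromWitness Pp
  e (false ∷ true  ∷ true  ∷ [] , _) = q , fromWitness Pq
  e (true  ∷ false ∷ true  ∷ [] , _) = r , fromWitness Pr
  e (false ∷ false ∷ false ∷ [] , ())
  e (false ∷ true  ∷ false ∷ [] , ())

  e-inj : ∀ {d d′} → e d ≡ e d′ → d ≡ d′
  e-inj {true  ∷ true  ∷ false ∷ [] , _} {true  ∷ true  ∷ false ∷ [] , _} _ = refl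
  e-inj {true  ∷ true  ∷ false ∷ [] , _} {false ∷ true  ∷ true  ∷ [] , _} eq = contradiction (cong proj₁ eq) p≢q
  e-inj {true  ∷ true  ∷ false ∷ [] , _} {true  ∷ false ∷ true  ∷ [] , _} eq = contradiction (cong proj₁ eq) p≢r
  e-inj {false ∷ true  ∷ true  ∷ [] , _} {true  ∷ true  ∷ false ∷ [] , _} eq = contradiction (sym (cong proj₁ eq)) p≢q
  e-inj {false ∷ true  ∷ true  ∷ [] , _} {false ∷ true  ∷ true  ∷ [] , _} _ = refl
  e-inj {false ∷ true  ∷ true  ∷ [] , _} {true  ∷ false ∷ true  ∷ [] , _} eq = contradiction (cong proj₁ eq) q≢r
  e-inj {true  ∷ false ∷ true  ∷ [] , _} {true  ∷ true  ∷ false ∷ [] , _} eq = contradiction (sym (cong proj₁ eq)) p≢r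
  e-inj {true  ∷ false ∷ true  ∷ [] , _} {false ∷ true  ∷ true  ∷ [] , _} eq = contradiction (sym (cong proj₁ eq)) q≢r
  e-inj {true  ∷ false ∷ true  ∷ [] , _} {true  ∷ false ∷ true  ∷ [] , _} _ = refl
  e-inj {false ∷ false ∷ false ∷ [] , ()}
  e-inj {false ∷ true  ∷ false ∷ [] , ()}
  e-inj {true  ∷ true  ∷ false ∷ [] , _} {false ∷ false ∷ false ∷ [] , ()}
  e-inj {true  ∷ true  ∷ false ∷ [] , _} {false ∷ true  ∷ false ∷ [] , ()}
  e-inj {true  ∷ false ∷ true  ∷ [] , _} {false ∷ false ∷ false ∷ [] , ()}
  e-inj {true  ∷ false ∷ true  ∷ [] , _} {false ∷ true  ∷ false ∷ [] , ()}
  e-inj {false ∷ true  ∷ true  ∷ [] , _} {false ∷ false ∷ false ∷ [] , ()}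
  e-inj {false ∷ true  ∷ true  ∷ [] , _} {false ∷ true  ∷ false ∷ [] , ()}

  incident : ∀ d v → proj₁ v ∈ proj₁ d → proj₁ (φ v) ∈ proj₁ (e d)
  incident (true  ∷ true  ∷ false ∷ [] , _) (zero , _)           _ = x∈p
  incident (true  ∷ true  ∷ false ∷ [] , _) (suc zero , _)       _ = y∈p
  incident (true  ∷ true  ∷ false ∷ [] , _) (suc (suc zero) , _) (there (there ()))
  incident (false ∷ true  ∷ true  ∷ [] , _) (zero , _)           ()
  incident (false ∷ true  ∷ true  ∷ [] , _) (suc zero , _)       _ = y∈q
  incident (false ∷ true  ∷ true  ∷ [] , _) (suc (suc zero) , _) _ = z∈q
  incident (true  ∷ false ∷ true  ∷ [] , _) (zero , _)           _ = x∈r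
  incident (true  ∷ false ∷ true  ∷ [] , _) (suc zero , _)       (there ())
  incident (true  ∷ false ∷ true  ∷ [] , _) (suc (suc zero) , _) _ = z∈r
  incident (false ∷ false ∷ false ∷ [] , ())
  incident (false ∷ true  ∷ false ∷ [] , ())

arrows⇒monoTriangle : ∀ {n k} → Arrows 3 (Berge K₃) k n →
                      ∀ (f : Subset n → Fin k) → MonoTriangle f
arrows⇒monoTriangle arr f with arr (f ∘ proj₁)
... | H , H⊑K , (c , mono) , φ , e , φ-inj , e-inj , incident =
  c , triangle
    (λ eq → contradiction (φ-inj {0ᵛ} {1ᵛ} (vertex-≡ eq)) λ ())
    (λ eq → contradiction (φ-inj {1ᵛ} {2ᵛ} (vertex-≡ eq)) λ ())
    (λ eq → contradiction (φ-inj {0ᵛ} {2ᵛ} (vertex-≡ eq)) λ ())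
    (λ eq → contradiction (e-inj {01ᵉ} {12ᵉ} (edge-≡ eq)) λ ())
    (λ eq → contradiction (e-inj {12ᵉ} {02ᵉ} (edge-≡ eq)) λ ())
    (λ eq → contradiction (e-inj {01ᵉ} {02ᵉ} (edge-≡ eq)) λ ())
    (class (e 01ᵉ)) (class (e 12ᵉ)) (class (e 02ᵉ))
    (incident 01ᵉ 0ᵛ here) (incident 01ᵉ 1ᵛ (there here))
    (incident 12ᵉ 1ᵛ (there here)) (incident 12ᵉ 2ᵛ (there (there here)))
    (incident 02ᵉ 0ᵛ here) (incident 02ᵉ 2ᵛ (there (there here)))
  where
  0ᵛ 1ᵛ 2ᵛ : Vertex (proj₁ K₃)
  0ᵛ = zero , here
  1ᵛ = suc zero , there here
  2ᵛ = suc (suc zero) , there (there here)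

  01ᵉ 12ᵉ 02ᵉ : Edge (proj₁ K₃)
  01ᵉ = true  ∷ true  ∷ false ∷ [] , _
  12ᵉ = false ∷ true  ∷ true  ∷ [] , _
  02ᵉ = true  ∷ false ∷ true  ∷ [] , _

  -- Injectivity of `φ` and `e` concerns points paired with membership proofs; as these proofs are
  -- irrelevant, equality of the first components is enough.
  vertex-≡ : {u v : Vertex H} → proj₁ u ≡ proj₁ v → u ≡ v
  vertex-≡ {x , i} {_ , j} refl = cong (x ,_) ([]=-irrelevant i j)

  edge-≡ : {d d′ : Edge H} → proj₁ d ≡ proj₁ d′ → d ≡ d′
  edge-≡ {p , i} {_ , j} refl = cong (p ,_) (T-irrelevant i j)

  class : ∀ d → ColourClass f c (proj₁ d)
  class d@(p , p∈E) = ℕ.≡ᵇ⇒≡ ∣ p ∣ 3 (proj₂ H⊑K p p∈E) , mono d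

-- A constructive minimum requires deciding the arrow relation. `Arrows` quantifies over
-- hypergraphs, so the decision goes through the finite search for a `MonoTriangle`.
arrows? : ∀ k n → Dec (Arrows 3 (Berge K₃) (suc k) n)
arrows? k n = map′ monoTriangle⇒arrows arrows⇒monoTriangle
  (allColourings? MonoTriangle monoTriangle-ext monoTriangle?)

least : ∀ {P : ℕ → Set} → Decidable P → ∀ {N} → P N → ∃[ n ] (P n × (∀ m → P m → n ℕ.≤ m))
least P? {zero} P0 = 0 , P0 , λ _ _ → z≤n
least {P} P? {suc N} PN with P? 0
... | yes P0 = 0 , P0 , λ _ _ → z≤n
... | no ¬P0 with least (P? ∘ suc) PN
...   | n , Pn , min = suc n , Pn , λ { zero P0 → contradiction P0 ¬P0 ; (suc m) Pm → s≤s (min m Pm) }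

-- Berge-triangle-free colour classes are sparse

⟦_⟧ : {A : Set} → Dec A → ℕ
⟦ yes _ ⟧ = 1
⟦ no _ ⟧  = 0

⟦⟧-true : {A : Set} (d : Dec A) → A → ⟦ d ⟧ ≡ 1
⟦⟧-true (yes _) a = refl
⟦⟧-true (no ¬a) a = contradiction a ¬a

⟦⟧-⇔ : {A B : Set} (d : Dec A) (e : Dec B) → (A → B) → (B → A) → ⟦ d ⟧ ≡ ⟦ e ⟧
⟦⟧-⇔ (yes _) (yes _) _ _ = refl
⟦⟧-⇔ (no _)  (no _)  _ _ = refl
⟦⟧-⇔ (yes a) (no ¬b) f _ = contradiction (f a) ¬b
⟦⟧-⇔ (no ¬a) (yes b) _ g = contradiction (g b) ¬a

sum-mono : ∀ {n} {f g : Fin n → ℕ} → (∀ i → f i ≤ g i) → sum f ≤ sum g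
sum-mono {zero}  f≤g = z≤n
sum-mono {suc n} f≤g = ℕ.+-mono-≤ (f≤g zero) (sum-mono (f≤g ∘ suc))

sum-const : ∀ n c → ∑[ i < n ] c ≡ n * c
sum-const zero c    = refl
sum-const (suc n) c = cong (_+_ c) (sum-const n c)

sum-zero : ∀ {n} {f : Fin n → ℕ} → (∀ i → f i ≡ 0) → sum f ≡ 0
sum-zero {n} f≡0 = trans (sum-cong-≗ f≡0) (trans (sum-const n 0) (ℕ.*-zeroʳ n))

≤-sum : ∀ {n} (f : Fin n → ℕ) i → f i ≤ sum f
≤-sum f zero    = ℕ.m≤m+n _ _
≤-sum f (suc i) = ℕ.≤-trans (≤-sum (f ∘ suc) i) (ℕ.m≤n+m _ _)

sum-⟦⟧-≤1 : ∀ {n} {A : Fin n → Set} (A? : Decidable A) →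
            (∀ {i j} → A i → A j → i ≡ j) → ∑[ i < n ] ⟦ A? i ⟧ ≤ 1
sum-⟦⟧-≤1 {zero}  A? uniq = z≤n
sum-⟦⟧-≤1 {suc n} A? uniq with A? zero
... | no  _ = sum-⟦⟧-≤1 (A? ∘ suc) λ Ai Aj → Fin.suc-injective (uniq Ai Aj)
... | yes A₀ = ℕ.≤-reflexive (cong suc (sum-zero λ i → none i (A? (suc i))))
  where
  none : ∀ i (d : Dec _) → ⟦ d ⟧ ≡ 0
  none i (yes Aᵢ) = contradiction (uniq A₀ Aᵢ) λ ()
  none i (no _)   = refl

sum-⟦≟⟧ : ∀ {n} (j : Fin n) → ∑[ i < n ] ⟦ i Fin.≟ j ⟧ ≡ 1
sum-⟦≟⟧ j = ℕ.≤-antisym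
  (sum-⟦⟧-≤1 (Fin._≟ j) λ { refl refl → refl })
  (ℕ.≤-trans (ℕ.≤-reflexive (sym (⟦⟧-true (j Fin.≟ j) refl))) (≤-sum (λ i → ⟦ i Fin.≟ j ⟧) j))

sum-⟦⟧-pos : ∀ {n} {A : Fin n → Set} (A? : Decidable A) {m} →
             ∑[ i < n ] ⟦ A? i ⟧ ≡ suc m → ∃[ i ] A i
sum-⟦⟧-pos {suc n} A? eq with A? zero
... | yes A₀ = zero , A₀
... | no  _  with i , Ai ← sum-⟦⟧-pos (A? ∘ suc) eq = suc i , Ai

2ab≤a²+b² : ∀ a b → 2 * (a * b) ≤ a * a + b * b
2ab≤a²+b² a b = [ ordered , swapped ∘ ordered ]′ (ℕ.≤-total a b)
  where
  ordered : ∀ {a b} → a ≤ b → 2 * (a * b) ≤ a * a + b * b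
  ordered {a} a≤b with c , refl ← ℕ.m≤n⇒∃[o]m+o≡n a≤b = subst (2 * (a * (a + c)) ≤_)
    (solve 2 (λ a c → con 2 :* (a :* (a :+ c)) :+ c :* c := a :* a :+ (a :+ c) :* (a :+ c)) refl a c)
    (ℕ.m≤m+n _ (c * c))
  swapped : 2 * (b * a) ≤ b * b + a * a → 2 * (a * b) ≤ a * a + b * b
  swapped = subst₂ _≤_ (cong (2 *_) (ℕ.*-comm b a)) (ℕ.+-comm (b * b) (a * a))

-- Three-element subsets and sums over triples

⁅_⨾_⨾_⁆ : ∀ {n} → Fin n → Fin n → Fin n → Subset n
⁅ x ⨾ y ⨾ z ⁆ = ⁅ x ⁆ ∪ (⁅ y ⁆ ∪ ⁅ z ⁆)

module _ {n : ℕ} where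

  ∈₁ : ∀ (x y z : Fin n) → x ∈ ⁅ x ⨾ y ⨾ z ⁆
  ∈₁ x y z = x∈p∪q⁺ (inj₁ (x∈⁅x⁆ x))

  ∈₂ : ∀ (x y z : Fin n) → y ∈ ⁅ x ⨾ y ⨾ z ⁆
  ∈₂ x y z = x∈p∪q⁺ (inj₂ (x∈p∪q⁺ (inj₁ (x∈⁅x⁆ y))))

  ∈₃ : ∀ (x y z : Fin n) → z ∈ ⁅ x ⨾ y ⨾ z ⁆
  ∈₃ x y z = x∈p∪q⁺ (inj₂ (x∈p∪q⁺ {p = ⁅ y ⁆} (inj₂ (x∈⁅x⁆ z))))

  ∈-triple : ∀ {w} (x y z : Fin n) → w ∈ ⁅ x ⨾ y ⨾ z ⁆ → w ≡ x ⊎ w ≡ y ⊎ w ≡ z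
  ∈-triple x y z w∈ with x∈p∪q⁻ ⁅ x ⁆ _ w∈
  ... | inj₁ w∈x = inj₁ (x∈⁅y⁆⇒x≡y x w∈x)
  ... | inj₂ w∈yz with x∈p∪q⁻ ⁅ y ⁆ _ w∈yz
  ...   | inj₁ w∈y = inj₂ (inj₁ (x∈⁅y⁆⇒x≡y y w∈y))
  ...   | inj₂ w∈z = inj₂ (inj₂ (x∈⁅y⁆⇒x≡y z w∈z))

  ∉-triple : ∀ {w} (x y z : Fin n) → w ≢ x → w ≢ y → w ≢ z → w ∉ ⁅ x ⨾ y ⨾ z ⁆
  ∉-triple x y z w≢x w≢y w≢z w∈ = [ w≢x , [ w≢y , w≢z ]′ ]′ (∈-triple x y z w∈)

  triple-swap : ∀ (x y z : Fin n) → ⁅ x ⨾ y ⨾ z ⁆ ≡ ⁅ y ⨾ x ⨾ z ⁆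
  triple-swap x y z = begin
    ⁅ x ⁆ ∪ (⁅ y ⁆ ∪ ⁅ z ⁆) ≡⟨ ∪-assoc ⁅ x ⁆ ⁅ y ⁆ ⁅ z ⁆ ⟨
    (⁅ x ⁆ ∪ ⁅ y ⁆) ∪ ⁅ z ⁆ ≡⟨ cong (_∪ ⁅ z ⁆) (∪-comm ⁅ x ⁆ ⁅ y ⁆) ⟩
    (⁅ y ⁆ ∪ ⁅ x ⁆) ∪ ⁅ z ⁆ ≡⟨ ∪-assoc ⁅ y ⁆ ⁅ x ⁆ ⁅ z ⁆ ⟩
    ⁅ y ⁆ ∪ (⁅ x ⁆ ∪ ⁅ z ⁆) ∎
    where open ≡-Reasoning

  triple-rot : ∀ (x y z : Fin n) → ⁅ x ⨾ y ⨾ z ⁆ ≡ ⁅ y ⨾ z ⨾ x ⁆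
  triple-rot x y z = trans (triple-swap x y z) (cong (⁅ y ⁆ ∪_) (∪-comm ⁅ x ⁆ ⁅ z ⁆))

∣pair∣≤2 : ∀ {n} (x y : Fin n) → ∣ ⁅ x ⁆ ∪ ⁅ y ⁆ ∣ ≤ 2
∣pair∣≤2 {suc n} zero zero =
  s≤s (ℕ.≤-trans (ℕ.≤-reflexive (trans (cong ∣_∣ (∪-idem (Sub.⊥ {n}))) (∣⊥∣≡0 n))) z≤n)
∣pair∣≤2 zero (suc y) = s≤s (ℕ.≤-reflexive (trans (cong ∣_∣ (∪-identityˡ ⁅ y ⁆)) (∣⁅x⁆∣≡1 y)))
∣pair∣≤2 (suc x) zero = s≤s (ℕ.≤-reflexive (trans (cong ∣_∣ (∪-identityʳ ⁅ x ⁆)) (∣⁅x⁆∣≡1 x)))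
∣pair∣≤2 (suc x) (suc y) = ∣pair∣≤2 x y

∣⁅x⁆∪p∣ : ∀ {n} (x : Fin n) {p} → x ∉ p → ∣ ⁅ x ⁆ ∪ p ∣ ≡ suc ∣ p ∣
∣⁅x⁆∪p∣ zero {true ∷ p}  x∉p = contradiction here x∉p
∣⁅x⁆∪p∣ zero {false ∷ p} x∉p = cong (suc ∘ ∣_∣) (∪-identityˡ p)
∣⁅x⁆∪p∣ (suc x) {true ∷ p}  x∉p = cong suc (∣⁅x⁆∪p∣ x (x∉p ∘ there))
∣⁅x⁆∪p∣ (suc x) {false ∷ p} x∉p = ∣⁅x⁆∪p∣ x (x∉p ∘ there)

module _ {n : ℕ} where

  ∣triple∣≡3 : ∀ {x y z : Fin n} → x ≢ y → y ≢ z → x ≢ z → ∣ ⁅ x ⨾ y ⨾ z ⁆ ∣ ≡ 3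
  ∣triple∣≡3 {x} {y} {z} x≢y y≢z x≢z = begin
    ∣ ⁅ x ⨾ y ⨾ z ⁆ ∣        ≡⟨ ∣⁅x⁆∪p∣ x x∉yz ⟩
    suc ∣ ⁅ y ⁆ ∪ ⁅ z ⁆ ∣    ≡⟨ cong suc (∣⁅x⁆∪p∣ y (x≢y⇒x∉⁅y⁆ y≢z)) ⟩
    2 + ∣ ⁅ z ⁆ ∣            ≡⟨ cong (_+_ 2) (∣⁅x⁆∣≡1 z) ⟩
    3                        ∎
    where
    open ≡-Reasoning
    x∉yz : x ∉ ⁅ y ⁆ ∪ ⁅ z ⁆
    x∉yz x∈ = [ x≢y⇒x∉⁅y⁆ x≢y , x≢y⇒x∉⁅y⁆ x≢z ]′ (x∈p∪q⁻ ⁅ y ⁆ _ x∈)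

  ∣triple∣≡3⇒≢ : ∀ (x y z : Fin n) → ∣ ⁅ x ⨾ y ⨾ z ⁆ ∣ ≡ 3 → x ≢ y
  ∣triple∣≡3⇒≢ x y z ∣xyz∣≡3 refl =
    contradiction (subst (_≤ 2) (trans (cong ∣_∣ xz≡xxz) ∣xyz∣≡3) (∣pair∣≤2 x z)) λ { (s≤s (s≤s ())) }
    where
    xz≡xxz : ⁅ x ⁆ ∪ ⁅ z ⁆ ≡ ⁅ x ⨾ x ⨾ z ⁆
    xz≡xxz = sym (trans (sym (∪-assoc ⁅ x ⁆ ⁅ x ⁆ ⁅ z ⁆)) (cong (_∪ ⁅ z ⁆) (∪-idem ⁅ x ⁆)))

module Sums (n : ℕ) where

  ∑² : (Fin n → Fin n → ℕ) → ℕ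
  ∑² f = ∑[ x < n ] ∑[ y < n ] f x y

  ∑³ : (Fin n → Fin n → Fin n → ℕ) → ℕ
  ∑³ f = ∑[ x < n ] ∑² (f x)

  ∑²-cong : ∀ {f g : Fin n → Fin n → ℕ} → (∀ x y → f x y ≡ g x y) → ∑² f ≡ ∑² g
  ∑²-cong f≡g = sum-cong-≗ λ x → sum-cong-≗ (f≡g x)

  ∑³-cong : ∀ {f g : Fin n → Fin n → Fin n → ℕ} → (∀ x y z → f x y z ≡ g x y z) → ∑³ f ≡ ∑³ g
  ∑³-cong f≡g = sum-cong-≗ λ x → ∑²-cong (f≡g x)

  ∑³-mono : ∀ {f g : Fin n → Fin n → Fin n → ℕ} → (∀ x y z → f x y z ≤ g x y z) → ∑³ f ≤ ∑³ g
  ∑³-mono f≤g = sum-mono λ x → sum-mono λ y → sum-mono λ z → f≤g x y z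

  ∑³-+ : ∀ (f g : Fin n → Fin n → Fin n → ℕ) → ∑³ (λ x y z → f x y z + g x y z) ≡ ∑³ f + ∑³ g
  ∑³-+ f g = trans
    (sum-cong-≗ λ x → trans (sum-cong-≗ λ y → ∑-distrib-+ (f x y) (g x y))
                              (∑-distrib-+ (λ y → sum (f x y)) (λ y → sum (g x y))))
    (∑-distrib-+ (λ x → ∑² (f x)) (λ x → ∑² (g x)))

  ∑³-*ˡ : ∀ c (f : Fin n → Fin n → Fin n → ℕ) → ∑³ (λ x y z → c * f x y z) ≡ c * ∑³ f
  ∑³-*ˡ c f = sym (trans (*-distribˡ-sum c (λ x → ∑² (f x)))
    (sum-cong-≗ λ x → trans (*-distribˡ-sum c (λ y → sum (f x y)))
                              (sum-cong-≗ λ y → *-distribˡ-sum c (f x y))))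

  ∑³-swap₁₂ : ∀ (f : Fin n → Fin n → Fin n → ℕ) → ∑³ (λ x y z → f y x z) ≡ ∑³ f
  ∑³-swap₁₂ f = ∑-comm λ x y → sum (f y x)

  ∑³-swap₂₃ : ∀ (f : Fin n → Fin n → Fin n → ℕ) → ∑³ (λ x y z → f x z y) ≡ ∑³ f
  ∑³-swap₂₃ f = sum-cong-≗ λ x → ∑-comm λ y z → f x z y

-- Light pairs and Mantel's argument in one colour class

module Turán {n} {P : Subset n → Set} (P? : Decidable P)
             (∣P∣≡3 : ∀ {p} → P p → ∣ p ∣ ≡ 3) (free : ¬ Triangle P) where

  open Sums n

  Link : Fin n → Fin n → Fin n → Set
  Link x y z = P ⁅ x ⨾ y ⨾ z ⁆

  link? : ∀ x y z → Dec (Link x y z)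
  link? x y z = P? ⁅ x ⨾ y ⨾ z ⁆

  link-swap : ∀ {x y z} → Link x y z → Link y x z
  link-swap = subst P (triple-swap _ _ _)

  link-rot : ∀ {x y z} → Link x y z → Link y z x
  link-rot = subst P (triple-rot _ _ _)

  link⇒x≢y : ∀ {x y z} → Link x y z → x ≢ y
  link⇒x≢y = ∣triple∣≡3⇒≢ _ _ _ ∘ ∣P∣≡3

  link⇒y≢z : ∀ {x y z} → Link x y z → y ≢ z
  link⇒y≢z = link⇒x≢y ∘ link-rot

  link⇒x≢z : ∀ {x y z} → Link x y z → x ≢ z
  link⇒x≢z = ≢-sym ∘ link⇒y≢z ∘ link-rot

  -- z is the only third vertex completing {x,y} to an edge.  Edges are encoded by their ordered
  -- triples of vertices, so every edge is counted six times.
  Light : Fin n → Fin n → Fin n → Set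
  Light x y z = Link x y z × (∀ w → Link x y w → w ≡ z)

  light? : ∀ x y z → Dec (Light x y z)
  light? x y z = link? x y z ×-dec all? λ w → link? x y w →-dec w Fin.≟ z

  light-swap : ∀ {x y z} → Light x y z → Light y x z
  light-swap (e , u) = link-swap e , λ w e′ → u w (link-swap e′)

  heavy : ∀ {x y z} → Link x y z → ¬ Light x y z → ∃[ w ] (Link x y w × w ≢ z)
  heavy {x} {y} {z} e ¬light
    with w , ¬imp ← ¬∀⟶∃¬ n _ (λ w → link? x y w →-dec w Fin.≟ z) (λ all → ¬light (e , all))
    with link? x y w
  ... | yes e′ = w , e′ , λ w≡z → ¬imp λ _ → w≡z
  ... | no ¬e′ = contradiction (λ e′ → contradiction e′ ¬e′) ¬imp

  ∉⇒≢ : ∀ {x} {p q : Subset n} → x ∈ p → x ∉ q → p ≢ q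
  ∉⇒≢ x∈p x∉q refl = x∉q x∈p

  -- Two heavy sides of an edge close a Berge triangle: `xyw` carries `xy`, `yzv` carries `yz`, and
  -- `xyz` itself carries `xz`. The conditions on `w` and `v` keep the three edges distinct.
  ¬heavy² : ∀ {x y z v w} → Link x y z → Link x y w → w ≢ z → Link y z v → v ≢ x → ⊥
  ¬heavy² {x} {y} {z} {v} {w} xyz xyw w≢z yzv v≢x = free record
    { p = ⁅ x ⨾ y ⨾ w ⁆ ; q = ⁅ y ⨾ z ⨾ v ⁆ ; r = ⁅ x ⨾ y ⨾ z ⁆
    ; x≢y = link⇒x≢y xyz ; y≢z = link⇒y≢z xyz ; x≢z = link⇒x≢z xyz
    ; p≢q = ∉⇒≢ (∈₁ x y w) (∉-triple y z v (link⇒x≢y xyz) (link⇒x≢z xyz) (≢-sym v≢x))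
    ; q≢r = ∉⇒≢ (∈₃ y z v) (∉-triple x y z v≢x (≢-sym (link⇒x≢z yzv)) (≢-sym (link⇒y≢z yzv)))
    ; p≢r = ∉⇒≢ (∈₃ x y w) (∉-triple x y z (≢-sym (link⇒x≢z xyw)) (≢-sym (link⇒y≢z xyw)) w≢z)
    ; Pp = xyw ; Pq = yzv ; Pr = xyz
    ; x∈p = ∈₁ x y w ; y∈p = ∈₂ x y w ; y∈q = ∈₁ y z v ; z∈q = ∈₂ y z v
    ; x∈r = ∈₁ x y z ; z∈r = ∈₃ x y z }

  -- Any two sides become the first two sides of a suitable rotation of the edge, so `¬heavy²`
  -- leaves at most one heavy side.
  two-light : ∀ x y z → 2 * ⟦ link? x y z ⟧ ≤ ⟦ light? x y z ⟧ + ⟦ light? y z x ⟧ + ⟦ light? z x y ⟧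
  two-light x y z = count (link? x y z) (light? x y z) (light? y z x) (light? z x y)
    where
    count : (d : Dec (Link x y z)) (a : Dec (Light x y z)) (b : Dec (Light y z x)) (c : Dec (Light z x y)) →
            2 * ⟦ d ⟧ ≤ ⟦ a ⟧ + ⟦ b ⟧ + ⟦ c ⟧
    count (no _)  _       _       _       = z≤n
    count (yes _) (yes _) (yes _) _       = s≤s (s≤s z≤n)
    count (yes _) (yes _) (no _)  (yes _) = s≤s (s≤s z≤n)
    count (yes _) (no _)  (yes _) (yes _) = s≤s (s≤s z≤n)
    count (yes e) (no a)  (no b)  _
      with _ , f , f≢ ← heavy e a | _ , g , g≢ ← heavy (link-rot e) b =
      ⊥-elim (¬heavy² e f f≢ g g≢)
    count (yes e) (no a)  (yes _) (no c)
      with _ , f , f≢ ← heavy e a | _ , h , h≢ ← heavy (link-rot (link-rot e)) c =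
      ⊥-elim (¬heavy² (link-rot (link-rot e)) h h≢ f f≢)
    count (yes e) (yes _) (no b)  (no c)
      with _ , g , g≢ ← heavy (link-rot e) b | _ , h , h≢ ← heavy (link-rot (link-rot e)) c =
      ⊥-elim (¬heavy² (link-rot e) g g≢ h h≢)

  edges : ℕ
  edges = ∑³ λ x y z → ⟦ link? x y z ⟧

  -- A light pair determines its third vertex, so each light pair counts twice: this is the degree
  -- sum of the light graph.
  lights : ℕ
  lights = ∑³ λ x y z → ⟦ light? x y z ⟧

  -- The three terms of `two-light` are coordinate permutations of one another and have equal
  -- totals. In unordered counts, there are at least twice as many light pairs as edges.
  edges≤lights : 2 * edges ≤ 3 * lights
  edges≤lights = begin
    2 * edges ≡⟨ ∑³-*ˡ 2 (λ x y z → ⟦ link? x y z ⟧) ⟨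
    ∑³ (λ x y z → 2 * ⟦ link? x y z ⟧) ≤⟨ ∑³-mono two-light ⟩
    ∑³ (λ x y z → ⟦ light? x y z ⟧ + ⟦ light? y z x ⟧ + ⟦ light? z x y ⟧)
      ≡⟨ ∑³-+ _ (λ x y z → ⟦ light? z x y ⟧) ⟩
    ∑³ (λ x y z → ⟦ light? x y z ⟧ + ⟦ light? y z x ⟧) + ∑³ (λ x y z → ⟦ light? z x y ⟧)
      ≡⟨ cong₂ _+_ (∑³-+ _ (λ x y z → ⟦ light? y z x ⟧)) zxy ⟩
    lights + ∑³ (λ x y z → ⟦ light? y z x ⟧) + lights
      ≡⟨ cong (λ m → lights + m + lights) yzx ⟩
    lights + lights + lights ≡⟨ solve 1 (λ m → m :+ m :+ m := con 3 :* m) refl lights ⟩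
    3 * lights ∎
    where
    open ℕ.≤-Reasoning
    zxy : ∑³ (λ x y z → ⟦ light? z x y ⟧) ≡ lights
    zxy = trans (∑³-swap₂₃ (λ x y z → ⟦ light? y x z ⟧)) (∑³-swap₁₂ (λ x y z → ⟦ light? x y z ⟧))
    yzx : ∑³ (λ x y z → ⟦ light? y z x ⟧) ≡ lights
    yzx = trans (∑³-swap₁₂ (λ x y z → ⟦ light? x z y ⟧)) (∑³-swap₂₃ (λ x y z → ⟦ light? x y z ⟧))

  -- The adjacency matrix of the light graph; its entries are 0 or 1 by `ℓ≤1`.
  ℓ : Fin n → Fin n → ℕ
  ℓ x y = ∑[ z < n ] ⟦ light? x y z ⟧

  deg : Fin n → ℕ
  deg x = ∑[ y < n ] ℓ x y

  ℓ-swap : ∀ x y → ℓ x y ≡ ℓ y x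
  ℓ-swap x y = sum-cong-≗ λ z → ⟦⟧-⇔ (light? x y z) (light? y x z) light-swap light-swap

  ℓ≤1 : ∀ x y → ℓ x y ≤ 1
  ℓ≤1 x y = sum-⟦⟧-≤1 (light? x y) λ (e , _) (_ , u) → u _ e

  -- If `w ≢ z`, the edges `xyz`, `ywv`, `xwu` form a Berge triangle on `x`, `y`, `w`. The first
  -- differs from the others because it misses `w`; if `y` lay in `xwu`, then `u` would be `y` and
  -- `xyw` a second edge on the light pair `{x,y}`.
  common-neighbour : ∀ {x y z w u v} → Light x y z → Light x w u → Light y w v → w ≡ z
  common-neighbour {x} {y} {z} {w} {u} {v} (xyz , only-z) (xwu , _) (ywv , _)
    with Fin._≟_ w z
  ... | yes w≡z = w≡z
  ... | no  w≢z = ⊥-elim (free record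
    { p = ⁅ x ⨾ y ⨾ z ⁆ ; q = ⁅ y ⨾ w ⨾ v ⁆ ; r = ⁅ x ⨾ w ⨾ u ⁆
    ; x≢y = x≢y ; y≢z = y≢w ; x≢z = x≢w
    ; p≢q = ≢-sym (∉⇒≢ (∈₂ y w v) w∉xyz)
    ; q≢r = ∉⇒≢ (∈₁ y w v) (∉-triple x w u (≢-sym x≢y) y≢w
              λ { refl → w≢z (only-z w (link-swap (link-rot (link-rot xwu)))) })
    ; p≢r = ≢-sym (∉⇒≢ (∈₂ x w u) w∉xyz)
    ; Pp = xyz ; Pq = ywv ; Pr = xwu
    ; x∈p = ∈₁ x y z ; y∈p = ∈₂ x y z ; y∈q = ∈₁ y w v ; z∈q = ∈₂ y w v
    ; x∈r = ∈₁ x w u ; z∈r = ∈₂ x w u })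
    where
    x≢y = link⇒x≢y xyz
    x≢w = link⇒x≢y xwu
    y≢w = link⇒x≢y ywv
    w∉xyz = ∉-triple x y z (≢-sym x≢w) (≢-sym y≢w) w≢z

  -- Adjacent vertices have disjoint neighbourhoods up to the single vertex `z`; this exception is
  -- the extra 1 in `deg+deg`.
  ℓ+ℓ : ∀ {x y z} → Light x y z → ∀ w → ℓ x w + ℓ y w ≤ 1 + ⟦ w Fin.≟ z ⟧
  ℓ+ℓ {x} {y} {z} xyz w with ℓ x w in eq₁ | ℓ≤1 x w | ℓ y w in eq₂ | ℓ≤1 y w
  ... | 0 | _ | _ | b = ℕ.≤-trans b (ℕ.m≤m+n 1 _)
  ... | 1 | _ | 0 | _ = ℕ.m≤m+n 1 _
  ... | 1 | _ | 1 | _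
    with _ , xwu ← sum-⟦⟧-pos (light? x w) eq₁ | _ , ywv ← sum-⟦⟧-pos (light? y w) eq₂ =
      ℕ.≤-reflexive (cong suc (sym (⟦⟧-true (w Fin.≟ z) (common-neighbour xyz xwu ywv))))
  ... | 1 | _ | suc (suc _) | s≤s ()
  ... | suc (suc _) | s≤s () | _ | _

  deg+deg : ∀ {x y z} → Light x y z → deg x + deg y ≤ suc n
  deg+deg {x} {y} {z} xyz = begin
    deg x + deg y ≡⟨ ∑-distrib-+ (ℓ x) (ℓ y) ⟨
    ∑[ w < n ] (ℓ x w + ℓ y w) ≤⟨ sum-mono (ℓ+ℓ xyz) ⟩
    ∑[ w < n ] (1 + ⟦ w Fin.≟ z ⟧) ≡⟨ ∑-distrib-+ (λ _ → 1) (λ w → ⟦ w Fin.≟ z ⟧) ⟩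
    (∑[ w < n ] 1) + (∑[ w < n ] ⟦ w Fin.≟ z ⟧) ≡⟨ cong₂ _+_ (sum-const n 1) (sum-⟦≟⟧ z) ⟩
    n * 1 + 1 ≡⟨ cong (_+ 1) (ℕ.*-identityʳ n) ⟩
    n + 1 ≡⟨ ℕ.+-comm n 1 ⟩
    suc n ∎
    where open ℕ.≤-Reasoning

  deg² : ℕ
  deg² = ∑[ x < n ] (deg x * deg x)

  ∑light*deg : ∑³ (λ x y z → ⟦ light? x y z ⟧ * deg x) ≡ deg²
  ∑light*deg = sum-cong-≗ λ x → sym (trans
    (*-distribʳ-sum (deg x) (ℓ x))
    (sum-cong-≗ λ y → *-distribʳ-sum (deg x) (λ z → ⟦ light? x y z ⟧)))

  ∑light*deg′ : ∑³ (λ x y z → ⟦ light? x y z ⟧ * deg y) ≡ deg²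
  ∑light*deg′ = trans
    (∑³-cong (λ x y z → cong (_* deg y) (⟦⟧-⇔ (light? x y z) (light? y x z) light-swap light-swap)))
    (trans (∑³-swap₁₂ (λ x y z → ⟦ light? x y z ⟧ * deg x)) ∑light*deg)

  -- Mantel's double count of degrees, off by the one common neighbour allowed by ℓ+ℓ.
  2deg²≤ : deg² + deg² ≤ suc n * lights
  2deg²≤ = begin
    deg² + deg² ≡⟨ cong₂ _+_ ∑light*deg ∑light*deg′ ⟨
    ∑³ (λ x y z → ⟦ light? x y z ⟧ * deg x) + ∑³ (λ x y z → ⟦ light? x y z ⟧ * deg y)
      ≡⟨ ∑³-+ _ (λ x y z → ⟦ light? x y z ⟧ * deg y) ⟨
    ∑³ (λ x y z → ⟦ light? x y z ⟧ * deg x + ⟦ light? x y z ⟧ * deg y)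
      ≤⟨ ∑³-mono pointwise ⟩
    ∑³ (λ x y z → suc n * ⟦ light? x y z ⟧) ≡⟨ ∑³-*ˡ (suc n) (λ x y z → ⟦ light? x y z ⟧) ⟩
    suc n * lights ∎
    where
    open ℕ.≤-Reasoning
    pointwise : ∀ x y z → ⟦ light? x y z ⟧ * deg x + ⟦ light? x y z ⟧ * deg y ≤ suc n * ⟦ light? x y z ⟧
    pointwise x y z with light? x y z
    ... | no _  = z≤n
    ... | yes l = subst₂ _≤_
      (cong₂ _+_ (sym (ℕ.*-identityˡ (deg x))) (sym (ℕ.*-identityˡ (deg y))))
      (sym (ℕ.*-identityʳ (suc n))) (deg+deg l)

  -- The opposite bound on `deg²`. It is tight when every degree is `n/2`, the extremal case of
  -- Mantel's theorem.
  4n*lights≤ : 4 * n * lights ≤ 4 * deg² + n * (n * n)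
  4n*lights≤ = begin
    4 * n * lights ≡⟨ *-distribˡ-sum (4 * n) deg ⟩
    ∑[ x < n ] (4 * n * deg x) ≤⟨ sum-mono (λ x → pointwise (deg x)) ⟩
    ∑[ x < n ] (4 * (deg x * deg x) + n * n) ≡⟨ ∑-distrib-+ (λ x → 4 * (deg x * deg x)) (λ _ → n * n) ⟩
    (∑[ x < n ] (4 * (deg x * deg x))) + (∑[ x < n ] (n * n))
      ≡⟨ cong₂ _+_ (sym (*-distribˡ-sum 4 (λ x → deg x * deg x))) (sum-const n (n * n)) ⟩
    4 * deg² + n * (n * n) ∎
    where
    open ℕ.≤-Reasoning
    -- AM–GM replaces Cauchy–Schwarz: 2 (2d) n ≤ (2d)² + n².
    pointwise : ∀ d → 4 * n * d ≤ 4 * (d * d) + n * n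
    pointwise d = subst₂ _≤_
      (solve 2 (λ d n → con 2 :* (con 2 :* d :* n) := con 4 :* n :* d) refl d n)
      (solve 2 (λ d n → con 2 :* d :* (con 2 :* d) :+ n :* n := con 4 :* (d :* d) :+ n :* n) refl d n)
      (2ab≤a²+b² (2 * d) n)

  -- Eliminating `deg²` from its two bounds gives `2(n - 1) * lights ≤ n³`, and `edges≤lights` turns
  -- this into `4(n - 1) * edges ≤ 3n³`, stated here without subtraction. As `edges` counts every
  -- edge six times, a class has at most about `n²/8` edges.
  4n*edges≤ : 4 * n * edges ≤ 4 * edges + 3 * (n * (n * n))
  4n*edges≤ = go n refl
    where
    open ℕ.≤-Reasoning
    n³ = n * (n * n)
    2m*lights≤ : ∀ m → n ≡ suc m → 2 * m * lights ≤ n³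
    2m*lights≤ m refl = ℕ.+-cancelʳ-≤ (2 * suc n * lights) _ _ (begin
      2 * m * lights + 2 * suc n * lights
        ≡⟨ solve 2 (λ m L → con 2 :* m :* L :+ con 2 :* (con 2 :+ m) :* L
                         := con 4 :* (con 1 :+ m) :* L) refl m lights ⟩
      4 * n * lights ≤⟨ 4n*lights≤ ⟩
      4 * deg² + n³ ≡⟨ solve 2 (λ D N → con 4 :* D :+ N := N :+ con 2 :* (D :+ D)) refl deg² n³ ⟩
      n³ + 2 * (deg² + deg²) ≤⟨ ℕ.+-monoʳ-≤ n³ (ℕ.*-monoʳ-≤ 2 2deg²≤) ⟩
      n³ + 2 * (suc n * lights) ≡⟨ cong (_+_ n³) (ℕ.*-assoc 2 (suc n) lights) ⟨
      n³ + 2 * suc n * lights ∎)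
    go : ∀ m → n ≡ m → 4 * m * edges ≤ 4 * edges + 3 * n³
    go zero    _ = z≤n
    go (suc m) n≡1+m = begin
      4 * suc m * edges
        ≡⟨ solve 2 (λ m T → con 4 :* (con 1 :+ m) :* T := con 4 :* T :+ con 2 :* m :* (con 2 :* T)) refl m edges ⟩
      4 * edges + 2 * m * (2 * edges) ≤⟨ ℕ.+-monoʳ-≤ (4 * edges) (ℕ.*-monoʳ-≤ (2 * m) edges≤lights) ⟩
      4 * edges + 2 * m * (3 * lights)
        ≡⟨ cong (_+_ (4 * edges))
             (solve 2 (λ m L → con 2 :* m :* (con 3 :* L) := con 3 :* (con 2 :* m :* L)) refl m lights) ⟩
      4 * edges + 3 * (2 * m * lights) ≤⟨ ℕ.+-monoʳ-≤ (4 * edges) (ℕ.*-monoʳ-≤ 3 (2m*lights≤ m n≡1+m)) ⟩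
      4 * edges + 3 * n³ ∎

-- Summing over the colours: the upper bound

module _ {n k} (f : Subset n → Fin k) (free : ¬ MonoTriangle f) where

  open Sums n

  module Class (c : Fin k) = Turán (colourClass? f c) proj₁ (λ t → free (c , t))

  total : ℕ
  total = ∑[ c < k ] Class.edges c

  private
    n³ = n * (n * n)
    n² = n * n

  total≤ : 4 * n * total ≤ 4 * total + k * (3 * n³)
  total≤ = begin
    4 * n * total ≡⟨ *-distribˡ-sum (4 * n) Class.edges ⟩
    ∑[ c < k ] (4 * n * Class.edges c) ≤⟨ sum-mono Class.4n*edges≤ ⟩
    ∑[ c < k ] (4 * Class.edges c + 3 * n³) ≡⟨ ∑-distrib-+ (λ c → 4 * Class.edges c) (λ _ → 3 * n³) ⟩
    (∑[ c < k ] (4 * Class.edges c)) + (∑[ c < k ] (3 * n³))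
      ≡⟨ cong₂ _+_ (sym (*-distribˡ-sum 4 Class.edges)) (sum-const k (3 * n³)) ⟩
    4 * total + k * (3 * n³) ∎
    where open ℕ.≤-Reasoning

  ∑⁴-comm : ∀ {k} (g : Fin n → Fin n → Fin n → Fin k → ℕ) →
            ∑³ (λ x y z → ∑[ c < k ] g x y z c) ≡ ∑[ c < k ] ∑³ (λ x y z → g x y z c)
  ∑⁴-comm g = trans
    (sum-cong-≗ λ x → trans (sum-cong-≗ λ y → ∑-comm (g x y)) (∑-comm λ y c → ∑[ z < n ] g x y z c))
    (∑-comm λ x c → ∑² λ y z → g x y z c)

  -- An ordered triple of distinct points lies in the class of its own colour; every other one lies
  -- on one of three diagonals of size `n²`.
  n³≤total : n³ ≤ total + 3 * n²
  n³≤total = begin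
    n³ ≡⟨ ∑³-1 ⟨
    ∑³ (λ x y z → 1) ≤⟨ ∑³-mono pointwise ⟩
    ∑³ (λ x y z → coloured x y z + (⟦ x Fin.≟ y ⟧ + ⟦ y Fin.≟ z ⟧ + ⟦ x Fin.≟ z ⟧))
      ≡⟨ ∑³-+ coloured _ ⟩
    ∑³ coloured + ∑³ (λ x y z → ⟦ x Fin.≟ y ⟧ + ⟦ y Fin.≟ z ⟧ + ⟦ x Fin.≟ z ⟧)
      ≡⟨ cong₂ _+_ (∑⁴-comm λ x y z c → ⟦ Class.link? c x y z ⟧) diagonals ⟩
    total + 3 * n² ∎
    where
    open ℕ.≤-Reasoning
    coloured : Fin n → Fin n → Fin n → ℕ
    coloured x y z = ∑[ c < k ] ⟦ Class.link? c x y z ⟧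

    ∑²-1 : ∑² (λ x y → 1) ≡ n²
    ∑²-1 = trans (sum-cong-≗ {n} λ x → trans (sum-const n 1) (ℕ.*-identityʳ n)) (sum-const n n)

    ∑³-1 : ∑³ (λ x y z → 1) ≡ n³
    ∑³-1 = trans (sum-cong-≗ {n} λ x → ∑²-1) (sum-const n n²)

    yz : ∑³ (λ x y z → ⟦ y Fin.≟ z ⟧) ≡ n²
    yz = trans (sum-cong-≗ {n} λ x → trans (∑-comm {n} {n} λ y z → ⟦ y Fin.≟ z ⟧)
                 (trans (sum-cong-≗ {n} λ z → sum-⟦≟⟧ z) (trans (sum-const n 1) (ℕ.*-identityʳ n))))
               (sum-const n n)

    xz : ∑³ (λ x y z → ⟦ x Fin.≟ z ⟧) ≡ n²
    xz = trans (∑³-swap₁₂ λ x y z → ⟦ y Fin.≟ z ⟧) yz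

    xy : ∑³ (λ x y z → ⟦ x Fin.≟ y ⟧) ≡ n²
    xy = trans (∑³-swap₂₃ λ x y z → ⟦ x Fin.≟ z ⟧) xz

    diagonals : ∑³ (λ x y z → ⟦ x Fin.≟ y ⟧ + ⟦ y Fin.≟ z ⟧ + ⟦ x Fin.≟ z ⟧) ≡ 3 * n²
    diagonals = trans (∑³-+ _ (λ x y z → ⟦ x Fin.≟ z ⟧))
      (trans (cong₂ _+_ (trans (∑³-+ _ (λ x y z → ⟦ y Fin.≟ z ⟧)) (cong₂ _+_ xy yz)) xz)
        (solve 1 (λ N → N :+ N :+ N := con 3 :* N) refl n²))

    pointwise : ∀ x y z → 1 ≤ coloured x y z + (⟦ x Fin.≟ y ⟧ + ⟦ y Fin.≟ z ⟧ + ⟦ x Fin.≟ z ⟧)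
    pointwise x y z with x Fin.≟ y | y Fin.≟ z | x Fin.≟ z
    ... | yes _  | _      | _      = ℕ.≤-trans (s≤s z≤n) (ℕ.m≤n+m _ (coloured x y z))
    ... | no _   | yes _  | _      = ℕ.≤-trans (s≤s z≤n) (ℕ.m≤n+m _ (coloured x y z))
    ... | no _   | no _   | yes _  = ℕ.≤-trans (s≤s z≤n) (ℕ.m≤n+m _ (coloured x y z))
    ... | no x≢y | no y≢z | no x≢z = ℕ.≤-trans
      (ℕ.≤-reflexive (sym (⟦⟧-true (Class.link? (f ⁅ x ⨾ y ⨾ z ⁆) x y z) (∣triple∣≡3 x≢y y≢z x≢z , refl))))
      (ℕ.≤-trans (≤-sum (λ c → ⟦ Class.link? c x y z ⟧) (f ⁅ x ⨾ y ⨾ z ⁆)) (ℕ.m≤m+n _ _))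

-- Multiply `n³≤total` by `4m`, where `n = suc m`. The coloured triples contribute at most `3k * n³`
-- by `total≤`, the diagonals at most `12 * n³`; cancelling `n³` leaves `4m ≤ 3k + 12`.
triangle-free⇒4n≤3k+16 : ∀ {n k} (f : Subset n → Fin k) → ¬ MonoTriangle f → 4 * n ≤ 3 * k + 16
triangle-free⇒4n≤3k+16 {zero}  f free = z≤n
triangle-free⇒4n≤3k+16 {n@(suc m)} {k} f free = begin
  4 * n ≡⟨ ℕ.*-suc 4 m ⟩
  4 + 4 * m ≤⟨ ℕ.+-monoʳ-≤ 4 (ℕ.*-cancelʳ-≤ (4 * m) (3 * k + 12) n (ℕ.*-cancelʳ-≤ _ _ (n * n) main)) ⟩
  4 + (3 * k + 12) ≡⟨ solve 1 (λ k → con 4 :+ (con 3 :* k :+ con 12) := con 3 :* k :+ con 16) refl k ⟩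
  3 * k + 16 ∎
  where
  open ℕ.≤-Reasoning
  t = total f free
  4mt≤ : 4 * m * t ≤ k * (3 * (n * (n * n)))
  4mt≤ = ℕ.+-cancelˡ-≤ (4 * t) _ _ (subst (_≤ 4 * t + k * (3 * (n * (n * n))))
    (solve 2 (λ m t → con 4 :* (con 1 :+ m) :* t := con 4 :* t :+ con 4 :* m :* t) refl m t)
    (total≤ f free))
  main : 4 * m * n * (n * n) ≤ (3 * k + 12) * n * (n * n)
  main = begin
    4 * m * n * (n * n)
      ≡⟨ solve 2 (λ m n → con 4 :* m :* n :* (n :* n) := con 4 :* m :* (n :* (n :* n))) refl m n ⟩
    4 * m * (n * (n * n)) ≤⟨ ℕ.*-monoʳ-≤ (4 * m) (n³≤total f free) ⟩
    4 * m * (t + 3 * (n * n)) ≡⟨ ℕ.*-distribˡ-+ (4 * m) t (3 * (n * n)) ⟩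
    4 * m * t + 4 * m * (3 * (n * n))
      ≤⟨ ℕ.+-mono-≤ 4mt≤ (ℕ.*-monoˡ-≤ (3 * (n * n)) (ℕ.*-monoʳ-≤ 4 (ℕ.n≤1+n m))) ⟩
    k * (3 * (n * (n * n))) + 4 * n * (3 * (n * n))
      ≡⟨ solve 2 (λ k n → k :* (con 3 :* (n :* (n :* n))) :+ con 4 :* n :* (con 3 :* (n :* n))
                       := (con 3 :* k :+ con 12) :* n :* (n :* n)) refl k n ⟩
    (3 * k + 12) * n * (n * n) ∎

-- Four times the number of vertices must exceed `3 * suc k + 16`. Of the summand 5, four units pay
-- for the 16 and one for the rounding in the division.
arrows-upper : ∀ k → Arrows 3 (Berge K₃) (suc k) (3 * suc k ℕ./ 4 + 5)
arrows-upper k = monoTriangle⇒arrows λ f → decidable-stable (monoTriangle? f) λ free →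
  ℕ.<⇒≱ bound (triangle-free⇒4n≤3k+16 f free)
  where
  open ℕ.≤-Reasoning
  a = 3 * suc k
  bound : a + 16 ℕ.< 4 * (a ℕ./ 4 + 5)
  bound = begin-strict
    a + 16 ≡⟨ cong (_+ 16) (m≡m%n+[m/n]*n a 4) ⟩
    a ℕ.% 4 + a ℕ./ 4 * 4 + 16 <⟨ ℕ.+-monoˡ-< 16 (ℕ.+-monoˡ-< (a ℕ./ 4 * 4) (m%n<n a 4)) ⟩
    4 + a ℕ./ 4 * 4 + 16 ≡⟨ solve 1 (λ q → con 4 :+ q :* con 4 :+ con 16 := con 4 :* (q :+ con 5)) refl (a ℕ./ 4) ⟩
    4 * (a ℕ./ 4 + 5) ∎

-- A colouring without monochromatic Berge triangles

module _ {n : ℕ} {p q : Subset n} where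

  ⊆∧∣≡∣⇒≡ : p ⊆ q → ∣ p ∣ ≡ ∣ q ∣ → p ≡ q
  ⊆∧∣≡∣⇒≡ p⊆q ∣p∣≡∣q∣ = ⊆-antisym p⊆q q⊆p
    where
    q⊆p : q ⊆ p
    q⊆p {x} x∈q with x ∈? p
    ... | yes x∈p = x∈p
    ... | no  x∉p = contradiction ∣p∣≡∣q∣ (ℕ.<⇒≢ (p⊂q⇒∣p∣<∣q∣ (p⊆q , x , x∈q , x∉p)))

module _ {n : ℕ} where

  ⁅x⁆⊆p : ∀ {x : Fin n} {p} → x ∈ p → ⁅ x ⁆ ⊆ p
  ⁅x⁆⊆p {x} {p} x∈p y∈ = subst (_∈ p) (sym (x∈⁅y⁆⇒x≡y x y∈)) x∈p

  ∪⊆ : ∀ {p q r : Subset n} → p ⊆ r → q ⊆ r → p ∪ q ⊆ r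
  ∪⊆ {p} p⊆r q⊆r x∈ = [ p⊆r , q⊆r ]′ (x∈p∪q⁻ p _ x∈)

  ∣p∣≡0⇒≡⊥ : ∀ {p : Subset n} → ∣ p ∣ ≡ 0 → p ≡ Sub.⊥
  ∣p∣≡0⇒≡⊥ ∣p∣≡0 = sym (⊆∧∣≡∣⇒≡ (⊆-min _) (trans (∣⊥∣≡0 n) (sym ∣p∣≡0)))

  ∣p∣≡0⇒∉ : ∀ {x} {p : Subset n} → ∣ p ∣ ≡ 0 → x ∉ p
  ∣p∣≡0⇒∉ ∣p∣≡0 x∈p = ∉⊥ (subst (_ ∈_) (∣p∣≡0⇒≡⊥ ∣p∣≡0) x∈p)

  ∣p∣≡1⇒≡⁅x⁆ : ∀ {x} {p : Subset n} → ∣ p ∣ ≡ 1 → x ∈ p → p ≡ ⁅ x ⁆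
  ∣p∣≡1⇒≡⁅x⁆ {x} ∣p∣≡1 x∈p = sym (⊆∧∣≡∣⇒≡ (⁅x⁆⊆p x∈p) (trans (∣⁅x⁆∣≡1 x) (sym ∣p∣≡1)))

  ∣p∣≡1⇒≡ : ∀ {x y} {p : Subset n} → ∣ p ∣ ≡ 1 → x ∈ p → y ∈ p → x ≡ y
  ∣p∣≡1⇒≡ {x} {y} ∣p∣≡1 x∈p y∈p =
    x∈⁅y⁆⇒x≡y y (subst (x ∈_) (∣p∣≡1⇒≡⁅x⁆ ∣p∣≡1 y∈p) x∈p)

  ∣pair∣≡2 : ∀ {x y : Fin n} → x ≢ y → ∣ ⁅ x ⁆ ∪ ⁅ y ⁆ ∣ ≡ 2
  ∣pair∣≡2 {x} {y} x≢y = trans (∣⁅x⁆∪p∣ x (x≢y⇒x∉⁅y⁆ x≢y)) (cong suc (∣⁅x⁆∣≡1 y))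

  ∣p∣≡2⇒pair : ∀ {x} {p : Subset n} → ∣ p ∣ ≡ 2 → x ∈ p → ∃[ y ] (x ≢ y × p ≡ ⁅ x ⁆ ∪ ⁅ y ⁆)
  ∣p∣≡2⇒pair {x} {p} ∣p∣≡2 x∈p with any? (λ y → y ∈? p ×-dec ¬? (x Fin.≟ y))
  ... | yes (y , y∈p , x≢y) =
    y , x≢y , sym (⊆∧∣≡∣⇒≡ (∪⊆ (⁅x⁆⊆p x∈p) (⁅x⁆⊆p y∈p)) (trans (∣pair∣≡2 x≢y) (sym ∣p∣≡2)))
  ... | no ¬∃y = contradiction (p⊆q⇒∣p∣≤∣q∣ p⊆⁅x⁆)
    (subst₂ (λ i j → ¬ i ≤ j) (sym ∣p∣≡2) (sym (∣⁅x⁆∣≡1 x)) λ { (s≤s ()) })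
    where
    p⊆⁅x⁆ : p ⊆ ⁅ x ⁆
    p⊆⁅x⁆ {y} y∈p with x Fin.≟ y
    ... | yes refl = x∈⁅x⁆ x
    ... | no  x≢y  = contradiction (y , y∈p , x≢y) ¬∃y

  ∣p∣≡2⇒¬triple : ∀ {x y z} {p : Subset n} → ∣ p ∣ ≡ 2 → x ≢ y → y ≢ z → x ≢ z →
                  x ∈ p → y ∈ p → z ∉ p
  ∣p∣≡2⇒¬triple ∣p∣≡2 x≢y y≢z x≢z x∈p y∈p z∈p = contradiction
    (subst₂ _≤_ (∣triple∣≡3 x≢y y≢z x≢z) ∣p∣≡2
      (p⊆q⇒∣p∣≤∣q∣ (∪⊆ (⁅x⁆⊆p x∈p) (∪⊆ (⁅x⁆⊆p y∈p) (⁅x⁆⊆p z∈p)))))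
    λ { (s≤s (s≤s ())) }

  weight : Subset n → ℕ
  weight p = ∑[ i < n ] (toℕ i * ⟦ i ∈? p ⟧)

  weight-pair : ∀ {x y} → x ≢ y → weight (⁅ x ⁆ ∪ ⁅ y ⁆) ≡ toℕ x + toℕ y
  weight-pair {x} {y} x≢y = begin
    weight (⁅ x ⁆ ∪ ⁅ y ⁆)
      ≡⟨ sum-cong-≗ (λ i → trans (cong (toℕ i *_) (indicator i (i ∈? (⁅ x ⁆ ∪ ⁅ y ⁆)) (i Fin.≟ x) (i Fin.≟ y)))
                                 (ℕ.*-distribˡ-+ (toℕ i) _ _)) ⟩
    ∑[ i < n ] (toℕ i * ⟦ i Fin.≟ x ⟧ + toℕ i * ⟦ i Fin.≟ y ⟧)
      ≡⟨ ∑-distrib-+ (λ i → toℕ i * ⟦ i Fin.≟ x ⟧) (λ i → toℕ i * ⟦ i Fin.≟ y ⟧) ⟩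
    ∑[ i < n ] (toℕ i * ⟦ i Fin.≟ x ⟧) + ∑[ i < n ] (toℕ i * ⟦ i Fin.≟ y ⟧)
      ≡⟨ cong₂ _+_ (pick x) (pick y) ⟩
    toℕ x + toℕ y ∎
    where
    open ≡-Reasoning
    indicator : ∀ i (d : Dec (i ∈ ⁅ x ⁆ ∪ ⁅ y ⁆)) (e : Dec (i ≡ x)) (f : Dec (i ≡ y)) → ⟦ d ⟧ ≡ ⟦ e ⟧ + ⟦ f ⟧
    indicator i d (yes refl) (yes refl) = contradiction refl x≢y
    indicator i d (yes refl) (no _) = ⟦⟧-true d (x∈p∪q⁺ (inj₁ (x∈⁅x⁆ i)))
    indicator i d (no _) (yes refl) = ⟦⟧-true d (x∈p∪q⁺ {p = ⁅ x ⁆} (inj₂ (x∈⁅x⁆ i)))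
    indicator i (no _)  (no _) (no _) = refl
    indicator i (yes i∈) (no i≢x) (no i≢y) =
      ⊥-elim ([ x≢y⇒x∉⁅y⁆ i≢x , x≢y⇒x∉⁅y⁆ i≢y ]′ (x∈p∪q⁻ ⁅ x ⁆ ⁅ y ⁆ i∈))
    same : ∀ i j (d : Dec (i ≡ j)) → toℕ i * ⟦ d ⟧ ≡ toℕ j * ⟦ d ⟧
    same i j (yes refl) = refl
    same i j (no _)     = trans (ℕ.*-zeroʳ (toℕ i)) (sym (ℕ.*-zeroʳ (toℕ j)))
    pick : ∀ j → ∑[ i < n ] (toℕ i * ⟦ i Fin.≟ j ⟧) ≡ toℕ j
    pick j = begin
      ∑[ i < n ] (toℕ i * ⟦ i Fin.≟ j ⟧) ≡⟨ sum-cong-≗ (λ i → same i j (i Fin.≟ j)) ⟩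
      ∑[ i < n ] (toℕ j * ⟦ i Fin.≟ j ⟧) ≡⟨ *-distribˡ-sum (toℕ j) (λ i → ⟦ i Fin.≟ j ⟧) ⟨
      toℕ j * ∑[ i < n ] ⟦ i Fin.≟ j ⟧ ≡⟨ cong (toℕ j *_) (sum-⟦≟⟧ j) ⟩
      toℕ j * 1 ≡⟨ ℕ.*-identityʳ (toℕ j) ⟩
      toℕ j ∎

  -- On pairs this is the classical edge colouring of a complete graph by `x + y` modulo `suc n`.
  -- Passing through `weight` avoids choosing an order of the two endpoints, and the modulus is
  -- nonzero even for `n = 0`.
  label : Subset n → Fin (suc n)
  label p = weight p mod suc n

-- Adding m ∸ x recovers y from (x + y) % m, so i ↦ x + i mod m separates the pairs through x.
%-cancelˡ : ∀ x {y y′ m} .{{_ : NonZero m}} → x ≤ m → y < m → y′ < m → (x + y) % m ≡ (x + y′) % m → y ≡ y′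
%-cancelˡ x {m = m} x≤m y<m y′<m eq = trans (sym (recover y<m))
  (trans (cong (λ s → ((m ∸ x) % m + s) % m) eq) (recover y′<m))
  where
  recover : ∀ {y} → y < m → ((m ∸ x) % m + (x + y) % m) % m ≡ y
  recover {y} y<m = begin
    ((m ∸ x) % m + (x + y) % m) % m ≡⟨ %-distribˡ-+ (m ∸ x) (x + y) m ⟨
    (m ∸ x + (x + y)) % m           ≡⟨ cong (_% m) (ℕ.+-assoc (m ∸ x) x y) ⟨
    (m ∸ x + x + y) % m             ≡⟨ cong (λ s → (s + y) % m) (ℕ.m∸n+n≡m x≤m) ⟩
    (m + y) % m                     ≡⟨ cong (_% m) (ℕ.+-comm m y) ⟩
    (y + m) % m                     ≡⟨ [m+n]%n≡m%n y m ⟩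
    y % m                           ≡⟨ m<n⇒m%n≡m y<m ⟩
    y                               ∎
    where open ≡-Reasoning

label-proper : ∀ {n x} {p q : Subset n} → ∣ p ∣ ≡ 2 → ∣ q ∣ ≡ 2 → x ∈ p → x ∈ q →
               label p ≡ label q → p ≡ q
label-proper {n} {x} ∣p∣≡2 ∣q∣≡2 x∈p x∈q eq
  with y , x≢y , refl ← ∣p∣≡2⇒pair ∣p∣≡2 x∈p | z , x≢z , refl ← ∣p∣≡2⇒pair ∣q∣≡2 x∈q =
  cong (λ y → ⁅ x ⁆ ∪ ⁅ y ⁆) (Fin.toℕ-injective
    (%-cancelˡ (toℕ x) (ℕ.m≤n⇒m≤1+n (bound x)) (s≤s (bound y)) (s≤s (bound z))
      (trans (sym (toℕ-label x≢y)) (trans (cong toℕ eq) (toℕ-label x≢z)))))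
  where
  bound : ∀ (i : Fin n) → toℕ i ≤ n
  bound i = ℕ.<⇒≤ (Fin.toℕ<n i)
  toℕ-label : ∀ {y} → x ≢ y → toℕ (label (⁅ x ⁆ ∪ ⁅ y ⁆)) ≡ (toℕ x + toℕ y) % suc n
  toℕ-label x≢y = trans (Fin.toℕ-fromℕ< (m%n<n (weight (⁅ x ⁆ ∪ ⁅ _ ⁆)) (suc n)))
                        (cong (_% suc n) (weight-pair x≢y))

-- An edge is replaced by its traces on the two halves, so that the side of a vertex can be found by
-- pattern matching.
data _∈ˢ_ {a b} : Fin a ⊎ Fin b → Subset a × Subset b → Set where
  left  : ∀ {i p q} → i ∈ p → inj₁ i ∈ˢ (p , q)
  right : ∀ {j p q} → j ∈ q → inj₂ j ∈ˢ (p , q)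

swap-∈ˢ : ∀ {a b} {v : Fin a ⊎ Fin b} {p} → v ∈ˢ p → Sum.swap v ∈ˢ swap p
swap-∈ˢ (left i∈p)  = right i∈p
swap-∈ˢ (right j∈q) = left j∈q

swapTriangle : ∀ {a b} {P : Subset a × Subset b → Set} {P′ : Subset b × Subset a → Set} →
               (∀ {p} → P p → P′ (swap p)) → BergeTriangle _∈ˢ_ P → BergeTriangle _∈ˢ_ P′
swapTriangle = mapTriangle Sum.swap
  (λ {u} {v} eq → trans (sym (swap-involutive u)) (trans (cong Sum.swap eq) (swap-involutive v)))
  swap (cong swap) swap-∈ˢ

module _ {a b : ℕ} where

  record Mixed (l : Fin (suc a)) (pq : Subset a × Subset b) : Set where
    constructor mixed
    field
      ∣left∣≡2  : ∣ proj₁ pq ∣ ≡ 2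
      ∣right∣≡1 : ∣ proj₂ pq ∣ ≡ 1
      label≡l   : label (proj₁ pq) ≡ l

  sharedˡ : ∀ {l i p p′ q q′} → Mixed l (p , q) → Mixed l (p′ , q′) → i ∈ p → i ∈ p′ → p ≡ p′
  sharedˡ (mixed c _ d) (mixed c′ _ d′) i∈p i∈p′ = label-proper c c′ i∈p i∈p′ (trans d (sym d′))

  sharedʳ : ∀ {l j p p′ q q′} → Mixed l (p , q) → Mixed l (p′ , q′) → j ∈ q → j ∈ q′ → q ≡ q′
  sharedʳ (mixed _ c _) (mixed _ c′ _) j∈q j∈q′ = trans (∣p∣≡1⇒≡⁅x⁆ c j∈q) (sym (∣p∣≡1⇒≡⁅x⁆ c′ j∈q′))

  -- Within one class, left traces that meet are equal because labels are proper, and right traces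
  -- that meet are equal because they are singletons. Three left vertices would share one pair; with
  -- a single right vertex, the two edges through it agree on both sides; with two or more, some
  -- singleton would hold two of them.
  mixed-free : ∀ {l} → ¬ BergeTriangle _∈ˢ_ (Mixed l)
  mixed-free (triangle x≢y y≢z x≢z _ _ _ Pp Pq _ (left x∈p) (left y∈p) (left y∈q) (left z∈q) _ _) =
    ∣p∣≡2⇒¬triple (Mixed.∣left∣≡2 Pp) (x≢y ∘ cong inj₁) (y≢z ∘ cong inj₁) (x≢z ∘ cong inj₁)
      x∈p y∈p (subst (_ ∈_) (sym (sharedˡ Pp Pq y∈p y∈q)) z∈q)
  mixed-free (triangle _ _ _ _ q≢r _ Pp Pq Pr
                       (left x∈p) (left y∈p) (left y∈q) (right z∈q) (left x∈r) (right z∈r)) =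
    q≢r (cong₂ _,_ (trans (sym (sharedˡ Pp Pq y∈p y∈q)) (sharedˡ Pp Pr x∈p x∈r)) (sharedʳ Pq Pr z∈q z∈r))
  mixed-free (triangle _ _ _ p≢q _ _ Pp Pq Pr
                       (left x∈p) (right y∈p) (right y∈q) (left z∈q) (left x∈r) (left z∈r)) =
    p≢q (cong₂ _,_ (trans (sharedˡ Pp Pr x∈p x∈r) (sym (sharedˡ Pq Pr z∈q z∈r))) (sharedʳ Pp Pq y∈p y∈q))
  mixed-free (triangle _ _ _ _ _ p≢r Pp Pq Pr
                       (right x∈p) (left y∈p) (left y∈q) (left z∈q) (right x∈r) (left z∈r)) =
    p≢r (cong₂ _,_ (trans (sharedˡ Pp Pq y∈p y∈q) (sharedˡ Pq Pr z∈q z∈r)) (sharedʳ Pp Pr x∈p x∈r))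
  mixed-free (triangle x≢y _ _ _ _ _ (mixed _ c _) _ _ (right x∈p) (right y∈p) _ _ _ _) =
    x≢y (cong inj₂ (∣p∣≡1⇒≡ c x∈p y∈p))
  mixed-free (triangle _ _ x≢z _ _ _ _ _ (mixed _ c _) _ _ _ _ (right x∈r) (right z∈r)) =
    x≢z (cong inj₂ (∣p∣≡1⇒≡ c x∈r z∈r))
  mixed-free (triangle _ y≢z _ _ _ _ _ (mixed _ c _) _ _ _ (right y∈q) (right z∈q) _ _) =
    y≢z (cong inj₂ (∣p∣≡1⇒≡ c y∈q z∈q))

  Pure : {C : Set} → (Subset a → C) → C → Subset a × Subset b → Set
  Pure f c (p , q) = ∣ q ∣ ≡ 0 × ColourClass f c p

  pure-free : ∀ {C} (f : Subset a → C) {c} → ¬ MonoTriangle f → ¬ BergeTriangle _∈ˢ_ (Pure f c)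
  pure-free f free (triangle x≢y y≢z x≢z p≢q q≢r p≢r (e , Pp) (e′ , Pq) (e″ , Pr)
                             (left x∈p) (left y∈p) (left y∈q) (left z∈q) (left x∈r) (left z∈r)) =
    free (_ , triangle (x≢y ∘ cong inj₁) (y≢z ∘ cong inj₁) (x≢z ∘ cong inj₁)
                (p≢q ∘ lift e e′) (q≢r ∘ lift e′ e″) (p≢r ∘ lift e e″)
                Pp Pq Pr x∈p y∈p y∈q z∈q x∈r z∈r)
    where
    lift : ∀ {p p′ : Subset a} {q q′ : Subset b} → ∣ q ∣ ≡ 0 → ∣ q′ ∣ ≡ 0 → p ≡ p′ → (p , q) ≡ (p′ , q′)
    lift ∣q∣≡0 ∣q′∣≡0 = λ p≡p′ → cong₂ _,_ p≡p′ (trans (∣p∣≡0⇒≡⊥ ∣q∣≡0) (sym (∣p∣≡0⇒≡⊥ ∣q′∣≡0)))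
  pure-free f free (triangle _ _ _ _ _ _ (e , _) _ _ (right x∈p) _ _ _ _ _) = ∣p∣≡0⇒∉ e x∈p
  pure-free f free (triangle _ _ _ _ _ _ (e , _) _ _ _ (right y∈p) _ _ _ _) = ∣p∣≡0⇒∉ e y∈p
  pure-free f free (triangle _ _ _ _ _ _ _ (e , _) _ _ _ _ (right z∈q) _ _) = ∣p∣≡0⇒∉ e z∈q


  pure-disjoint : ∀ {v} {p q : Subset a × Subset b} → ∣ proj₂ p ∣ ≡ 0 → ∣ proj₁ q ∣ ≡ 0 → v ∈ˢ p → ¬ v ∈ˢ q
  pure-disjoint _  e′ _           (left i∈q) = ∣p∣≡0⇒∉ e′ i∈q
  pure-disjoint e  _  (right j∈p) _          = ∣p∣≡0⇒∉ e j∈p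

-- Gluing colourings of the two halves

∈-split : ∀ a {b} {x : Fin (a + b)} {p} → x ∈ p → splitAt a x ∈ˢ (take a p , drop a p)
∈-split zero    x∈p = right x∈p
∈-split (suc a) here = left here
∈-split (suc a) {x = suc x} {s ∷ p} (there x∈p) with splitAt a x | ∈-split a x∈p
... | inj₁ _ | left  i∈ = left (there i∈)
... | inj₂ _ | right j∈ = right j∈

∣split∣ : ∀ a {b} (p : Subset (a + b)) → ∣ take a p ∣ + ∣ drop a p ∣ ≡ ∣ p ∣
∣split∣ zero    p           = refl
∣split∣ (suc a) (true  ∷ p) = cong suc (∣split∣ a p)
∣split∣ (suc a) (false ∷ p) = ∣split∣ a p

split-injective : ∀ a {b} → Injective _≡_ _≡_ (λ (p : Subset (a + b)) → take a p , drop a p)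
split-injective a {x = p} {q} eq = trans (sym (take++drop≡id a p))
  (trans (cong (λ (l , r) → l ++ r) eq) (take++drop≡id a q))

splitAt-injective : ∀ a {b} → Injective _≡_ _≡_ (splitAt a {b})
splitAt-injective a {b} {i} {j} eq =
  trans (sym (Fin.join-splitAt a b i)) (trans (cong (join a b) eq) (Fin.join-splitAt a b j))

TriangleFree : ℕ → Set → Set
TriangleFree n C = Σ[ f ∈ (Subset n → C) ] ¬ MonoTriangle f

recolour : ∀ {n} {C D : Set} (ι : C → D) → Injective _≡_ _≡_ ι → TriangleFree n C → TriangleFree n D
recolour ι ι-inj (f , free) = ι ∘ f , λ (c , t) →
  -- The target colour comes with no preimage under `ι`; the colour that `f` gives to the first edge
  -- of the triangle takes its place.
  free (_ , mapTriangle id id id id id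
    (λ (∣q∣≡3 , eq) → ∣q∣≡3 , ι-inj (trans eq (sym (proj₂ (BergeTriangle.Pp t))))) t)

module _ {a b} {C : Set} (F : TriangleFree a C) (G : TriangleFree b C) where

  private
    f = proj₁ F
    g = proj₁ G

  -- Edges inside one half share the colours C: the two halves cannot interact in a Berge triangle.
  pairColour : Subset a × Subset b → Fin (suc a) ⊎ Fin (suc b) ⊎ C
  pairColour (p , q) with ∣ q ∣
  ... | 0 = inj₂ (inj₂ (f p))
  ... | 1 = inj₁ (label p)
  ... | 2 = inj₂ (inj₁ (label q))
  ... | suc (suc (suc _)) = inj₂ (inj₂ (g q))

  -- Describes the shape of the triples of each colour, so that freeness is proved for the shapes
  -- and not by unfolding `pairColour`.
  Coloured : Fin (suc a) ⊎ Fin (suc b) ⊎ C → Subset a × Subset b → Set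
  Coloured (inj₁ l) p        = Mixed l p
  Coloured (inj₂ (inj₁ l)) p = Mixed l (swap p)
  Coloured (inj₂ (inj₂ c)) p = Pure f c p ⊎ Pure g c (swap p)

  coloured : ∀ p → ∣ proj₁ p ∣ + ∣ proj₂ p ∣ ≡ 3 → Coloured (pairColour p) p
  coloured (p , q) eq with ∣ q ∣ in ∣q∣≡
  ... | 0 = inj₁ (∣q∣≡ , trans (sym (ℕ.+-identityʳ _)) eq , refl)
  ... | 1 = mixed (ℕ.+-cancelʳ-≡ 1 _ 2 eq) ∣q∣≡ refl
  ... | 2 = mixed ∣q∣≡ (ℕ.+-cancelʳ-≡ 2 _ 1 eq) refl
  ... | 3 = inj₂ (ℕ.+-cancelʳ-≡ 3 _ 0 eq , ∣q∣≡ , refl)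
  ... | suc (suc (suc (suc m))) =
    contradiction (subst (4 + m ≤_) eq (ℕ.m≤n+m _ ∣ p ∣)) λ { (s≤s (s≤s (s≤s ()))) }

  -- Edges inside different halves are disjoint, while `p` meets `q` in `y` and `r` in `x`; hence
  -- all three lie in the same half.
  pure-triangle : ∀ {c} → BergeTriangle _∈ˢ_ (Coloured (inj₂ (inj₂ c))) →
                  BergeTriangle _∈ˢ_ (Pure f c) ⊎ BergeTriangle _∈ˢ_ (λ p → Pure g c (swap p))
  pure-triangle t@(triangle _ _ _ _ _ _ (inj₁ p) (inj₁ q) (inj₁ r) _ _ _ _ _ _) =
    inj₁ record { BergeTriangle t ; Pp = p ; Pq = q ; Pr = r }
  pure-triangle t@(triangle _ _ _ _ _ _ (inj₂ p) (inj₂ q) (inj₂ r) _ _ _ _ _ _) =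
    inj₂ record { BergeTriangle t ; Pp = p ; Pq = q ; Pr = r }
  pure-triangle (triangle _ _ _ _ _ _ (inj₁ p) (inj₂ q) _ _ y∈p y∈q _ _ _) =
    ⊥-elim (pure-disjoint (proj₁ p) (proj₁ q) y∈p y∈q)
  pure-triangle (triangle _ _ _ _ _ _ (inj₂ p) (inj₁ q) _ _ y∈p y∈q _ _ _) =
    ⊥-elim (pure-disjoint (proj₁ q) (proj₁ p) y∈q y∈p)
  pure-triangle (triangle _ _ _ _ _ _ (inj₁ p) _ (inj₂ r) x∈p _ _ _ x∈r _) =
    ⊥-elim (pure-disjoint (proj₁ p) (proj₁ r) x∈p x∈r)
  pure-triangle (triangle _ _ _ _ _ _ (inj₂ p) _ (inj₁ r) x∈p _ _ _ x∈r _) =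
    ⊥-elim (pure-disjoint (proj₁ r) (proj₁ p) x∈r x∈p)

  coloured-free : ∀ c → ¬ BergeTriangle _∈ˢ_ (Coloured c)
  coloured-free (inj₁ l)        = mixed-free
  coloured-free (inj₂ (inj₁ l)) = mixed-free ∘ swapTriangle id
  coloured-free (inj₂ (inj₂ c)) =
    [ pure-free f (proj₂ F) , pure-free g (proj₂ G) ∘ swapTriangle id ]′ ∘ pure-triangle

  combine : TriangleFree (a + b) (Fin (suc a) ⊎ Fin (suc b) ⊎ C)
  combine = pairColour ∘ split , λ (c , t) → coloured-free c
    (mapTriangle (splitAt a) (splitAt-injective a) split (split-injective a) (∈-split a)
      (λ {p} (∣p∣≡3 , eq) → subst (λ c → Coloured c (split p)) eq (coloured (split p) (trans (∣split∣ a p) ∣p∣≡3))) t)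
    where
    split : Subset (a + b) → Subset a × Subset b
    split p = take a p , drop a p

-- Counting colours in the recursive halving

⌈n/2⌉≤1+⌊n/2⌋ : ∀ n → ⌈ n /2⌉ ≤ suc ⌊ n /2⌋
⌈n/2⌉≤1+⌊n/2⌋ n = ℕ.⌊n/2⌋-mono (ℕ.n≤1+n (suc n))

n≤2m⇒⌈n/2⌉≤m : ∀ {m n} → n ≤ 2 * m → ⌈ n /2⌉ ≤ m
n≤2m⇒⌈n/2⌉≤m {m} n≤2m = subst (_ ≤_)
  (sym (ℕ.n≡⌈n+n/2⌉ m)) (ℕ.⌈n/2⌉-mono (subst (λ s → _ ≤ m + s) (ℕ.+-identityʳ m) n≤2m))

⊎-Fin : ∀ {m n o} → Fin m ⊎ Fin n ⊎ Fin o → Fin (m + (n + o))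
⊎-Fin {m} {n} {o} = join m (n + o) ∘ Sum.map₂ (join n o)

join-injective : ∀ m n → Injective _≡_ _≡_ (join m n)
join-injective m n {i} {j} eq =
  trans (sym (Fin.splitAt-join m n i)) (trans (cong (splitAt m) eq) (Fin.splitAt-join m n j))

⊎-Fin-injective : ∀ {m n o} → Injective _≡_ _≡_ (⊎-Fin {m} {n} {o})
⊎-Fin-injective {m} {n} {o} {i} {j} = map₂-injective ∘ join-injective m (n + o)
  where
  map₂-injective : ∀ {i j} → Sum.map₂ (join n o) i ≡ Sum.map₂ (join n o) j → i ≡ j
  map₂-injective {inj₁ _} {inj₁ _} refl = refl
  map₂-injective {inj₂ _} {inj₂ _} eq = cong inj₂ (join-injective n o (inj₂-injective eq))

-- Each of the `d` halvings costs three colours beyond the main term: one for each modulus `suc a`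
-- and `suc b`, and one because the larger half `b` may be `suc a`.
triangle-free-colouring : ∀ d {n K} → n ≤ 2 ^ d → 2 * n + 3 * d < K → TriangleFree n (Fin K)
triangle-free-colouring zero {K = suc K} n≤1 _ = (λ _ → zero) , λ (_ , t) →
  BergeTriangle.x≢y t (unique n≤1 _ _)
  where
  unique : ∀ {n} → n ≤ 1 → (x y : Fin n) → x ≡ y
  unique (s≤s z≤n) zero zero = refl
triangle-free-colouring (suc d) {n} {K} n≤2^1+d 2n+3d<K =
  subst (λ n → TriangleFree n (Fin K)) (ℕ.⌊n/2⌋+⌈n/2⌉≡n n)
    (recolour (λ c → inject≤ (⊎-Fin c) enough) (⊎-Fin-injective ∘ Fin.inject≤-injective enough enough _ _)
      -- Both halves use the `suc (2 * b + 3 * d)` colours required by the larger one, which gives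
      -- them a common colour set.
      (combine (triangle-free-colouring d (ℕ.≤-trans a≤b b≤2^d)
                 (s≤s (ℕ.+-monoˡ-≤ (3 * d) (ℕ.*-monoʳ-≤ 2 a≤b))))
               (triangle-free-colouring d b≤2^d (s≤s ℕ.≤-refl))))
  where
  a = ⌊ n /2⌋
  b = ⌈ n /2⌉
  a≤b : a ≤ b
  a≤b = ℕ.⌊n/2⌋≤⌈n/2⌉ n
  b≤2^d : b ≤ 2 ^ d
  b≤2^d = n≤2m⇒⌈n/2⌉≤m n≤2^1+d
  enough : suc a + (suc b + suc (2 * b + 3 * d)) ≤ K
  enough = begin
    suc a + (suc b + suc (2 * b + 3 * d))
      ≡⟨ solve 3 (λ a b d → con 1 :+ a :+ (con 1 :+ b :+ (con 1 :+ (con 2 :* b :+ con 3 :* d)))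
                         := a :+ con 2 :* b :+ con 3 :* d :+ con 3 :+ b) refl a b d ⟩
    a + 2 * b + 3 * d + 3 + b ≤⟨ ℕ.+-monoʳ-≤ (a + 2 * b + 3 * d + 3) (⌈n/2⌉≤1+⌊n/2⌋ n) ⟩
    a + 2 * b + 3 * d + 3 + suc a
      ≡⟨ solve 3 (λ a b d → a :+ con 2 :* b :+ con 3 :* d :+ con 3 :+ (con 1 :+ a)
                         := con 1 :+ (con 2 :* (a :+ b) :+ con 3 :* (con 1 :+ d))) refl a b d ⟩
    suc (2 * (a + b) + 3 * suc d) ≡⟨ cong (λ n → suc (2 * n + 3 * suc d)) (ℕ.⌊n/2⌋+⌈n/2⌉≡n n) ⟩
    suc (2 * n + 3 * suc d) ≤⟨ 2n+3d<K ⟩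
    K ∎
    where open ℕ.≤-Reasoning

arrows-lower : ∀ {k n} d → n ≤ 2 ^ d → Arrows 3 (Berge K₃) k n → k ≤ 2 * n + 3 * d
arrows-lower d n≤2^d arr = ℕ.≮⇒≥ λ 2n+3d<k →
  let f , free = triangle-free-colouring d n≤2^d 2n+3d<k in free (arrows⇒monoTriangle arr f)

-- Asymptotics

ceil-log : ∀ n → ∃[ d ] (suc n ≤ 2 ^ d × 2 ^ d ≤ 2 * suc n)
ceil-log zero = 0 , s≤s z≤n , s≤s z≤n
ceil-log (suc n) with ceil-log n
... | d , n<2^d , 2^d≤2n with suc (suc n) ℕ.≤? 2 ^ d
...   | yes n+1<2^d = d , n+1<2^d , ℕ.≤-trans 2^d≤2n (ℕ.*-monoʳ-≤ 2 (ℕ.n≤1+n (suc n)))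
...   | no  n+1≮2^d = suc d
  , ℕ.≤-trans (s≤s (ℕ.m≤n+m (suc n) n)) (subst (_≤ 2 * 2 ^ d)
      (solve 1 (λ n → con 2 :* (con 1 :+ n) := con 1 :+ (n :+ (con 1 :+ n))) refl n)
      (ℕ.*-monoʳ-≤ 2 n<2^d))
  , ℕ.*-monoʳ-≤ 2 (ℕ.≤-trans (ℕ.n≤1+n _) (ℕ.≰⇒> n+1≮2^d))

-- A quadratic bound suffices to make the logarithm at most a multiple of the square root. The
-- induction step rests on `(d + 2)² ≤ 2(d + 1)²`, which fails for `d` equal to 0 or 1; hence three
-- base cases.
1+d²≤4*2^d : ∀ d → suc d * suc d ≤ 4 * 2 ^ d
1+d²≤4*2^d 0 = s≤s z≤n
1+d²≤4*2^d 1 = s≤s (s≤s (s≤s (s≤s z≤n)))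
1+d²≤4*2^d 2 = ℕ.m≤m+n 9 7
1+d²≤4*2^d (suc d@(suc (suc e))) = begin
  (4 + e) * (4 + e) ≤⟨ ℕ.m≤m+n _ (2 + 4 * e + e * e) ⟩
  (4 + e) * (4 + e) + (2 + 4 * e + e * e)
    ≡⟨ solve 1 (λ e → (con 4 :+ e) :* (con 4 :+ e) :+ (con 2 :+ con 4 :* e :+ e :* e)
                   := con 2 :* ((con 3 :+ e) :* (con 3 :+ e))) refl e ⟩
  2 * ((3 + e) * (3 + e)) ≤⟨ ℕ.*-monoʳ-≤ 2 (1+d²≤4*2^d d) ⟩
  2 * (4 * 2 ^ (2 + e)) ≡⟨ solve 1 (λ x → con 2 :* (con 4 :* x) := con 4 :* (con 2 :* x)) refl (2 ^ (2 + e)) ⟩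
  4 * 2 ^ (3 + e) ∎
  where open ℕ.≤-Reasoning

m²≤n²⇒m≤n : ∀ {m n} → m * m ≤ n * n → m ≤ n
m²≤n²⇒m≤n m²≤n² = ℕ.≮⇒≥ λ n<m → ℕ.<⇒≱ (ℕ.*-mono-< n<m n<m) m²≤n²

-- The shift by 4 makes 2 ^ log k ≥ k + 5, an upper bound for the Ramsey number.
log : ℕ → ℕ
log k = proj₁ (ceil-log (k + 4))

log-sublinear : ∀ q → ∃[ N ] (∀ k → N ≤ k → 3 * log k * suc q ≤ k)
-- Squares are compared. Here `432 = 9 * 48`, with 9 from `3 * 3` and 48 from `8 * (k + 5) ≤ 48 * k`
-- for positive `k`.
log-sublinear q = 432 * (Q * Q) , λ k N≤k → m²≤n²⇒m≤n (bound k N≤k)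
  where
  Q = suc q
  open ℕ.≤-Reasoning
  bound : ∀ k → 432 * (Q * Q) ≤ k → 3 * log k * Q * (3 * log k * Q) ≤ k * k
  bound k@(suc k′) N≤k = begin
    3 * d * Q * (3 * d * Q)
      ≡⟨ solve 2 (λ d Q → con 3 :* d :* Q :* (con 3 :* d :* Q)
                       := con 9 :* (Q :* Q) :* (d :* d)) refl d Q ⟩
    9 * (Q * Q) * (d * d) ≤⟨ ℕ.*-monoʳ-≤ (9 * (Q * Q)) d²≤48k ⟩
    9 * (Q * Q) * (48 * k)
      ≡⟨ solve 2 (λ Q k → con 9 :* (Q :* Q) :* (con 48 :* k) := con 432 :* (Q :* Q) :* k) refl Q k ⟩
    432 * (Q * Q) * k ≤⟨ ℕ.*-monoˡ-≤ k N≤k ⟩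
    k * k ∎
    where
    d = log k
    d²≤48k : d * d ≤ 48 * k
    d²≤48k = begin
      d * d ≤⟨ ℕ.*-mono-≤ (ℕ.n≤1+n d) (ℕ.n≤1+n d) ⟩
      suc d * suc d ≤⟨ 1+d²≤4*2^d d ⟩
      4 * 2 ^ d ≤⟨ ℕ.*-monoʳ-≤ 4 (proj₂ (proj₂ (ceil-log (k + 4)))) ⟩
      4 * (2 * suc (k + 4)) ≤⟨ ℕ.m≤m+n _ (40 * k′) ⟩
      4 * (2 * suc (suc k′ + 4)) + 40 * k′
        ≡⟨ solve 1 (λ k → con 4 :* (con 2 :* (con 1 :+ (con 1 :+ k :+ con 4))) :+ con 40 :* k
                       := con 48 :* (con 1 :+ k)) refl k′ ⟩
      48 * k ∎

-- From natural numbers to rational estimates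

toℚᵘ-/ : ∀ a i → toℚᵘ (+ a / suc i) ℚᵘ.≃ mkℚᵘ (+ a) i
toℚᵘ-/ a i = ℚ.toℚᵘ-fromℚᵘ (mkℚᵘ (+ a) i)

-- A positive `ε` with denominator `suc q` is at least `1 / suc q`, so a condition on natural
-- numbers for each denominator suffices.
littleO : (e : ℕ → ℕ) → (∀ q → ∃[ N ] (∀ k → N ≤ k → e k * suc q ≤ k)) → LittleO (λ k → + e k / 1)
littleO e sub (mkℚ (+ zero) q _) (ℚ.*<* (ℤ.+<+ ()))
littleO e sub (mkℚ -[1+ _ ] q _) (ℚ.*<* ())
littleO e sub ε@(mkℚ (+ suc p) q _) _ with N , small ← sub q = N , bound
  where
  open ℚᵘ.≤-Reasoning
  bound : ∀ k → N ≤ k → ℚ.∣ + e k / 1 ∣ ℚ.≤ ε ℚ.* (+ k / 1)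
  bound k N≤k = ℚ.toℚᵘ-cancel-≤ (begin
    toℚᵘ ℚ.∣ + e k / 1 ∣     ≃⟨ ℚ.toℚᵘ-homo-∣-∣ (+ e k / 1) ⟩
    ℚᵘ.∣ toℚᵘ (+ e k / 1) ∣  ≃⟨ ℚᵘ.∣-∣-cong (toℚᵘ-/ (e k) 0) ⟩
    mkℚᵘ (+ e k) 0           ≤⟨ ℚᵘ.*≤* (subst₂ ℤ._≤_ (ℤ.pos-* (e k) _)
                                 (trans (ℤ.pos-* (suc p * k) 1) (cong (ℤ._* + 1) (ℤ.pos-* (suc p) k)))
                                 (ℤ.+≤+ crossed)) ⟩
    toℚᵘ ε ℚᵘ.* mkℚᵘ (+ k) 0 ≃⟨ ℚᵘ.*-congˡ {toℚᵘ ε} (toℚᵘ-/ k 0) ⟨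
    toℚᵘ ε ℚᵘ.* toℚᵘ (+ k / 1) ≃⟨ ℚ.toℚᵘ-homo-* ε (+ k / 1) ⟨
    toℚᵘ (ε ℚ.* (+ k / 1))   ∎)
    where
    crossed : e k * (suc q * 1) ≤ suc p * k * 1
    crossed = subst₂ _≤_ (cong (e k *_) (sym (ℕ.*-identityʳ (suc q)))) (sym (ℕ.*-identityʳ (suc p * k)))
      (ℕ.≤-trans (small k N≤k) (ℕ.m≤n*m k (suc p)))

/-≤-+ : ∀ {a b c i j l} → a * (suc j * suc l) ≤ (b * suc l + c * suc j) * suc i →
        + a / suc i ℚ.≤ + b / suc j ℚ.+ + c / suc l
/-≤-+ {a} {b} {c} {i} {j} {l} crossed = ℚ.toℚᵘ-cancel-≤ (begin
  toℚᵘ (+ a / suc i) ≃⟨ toℚᵘ-/ a i ⟩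
  mkℚᵘ (+ a) i ≤⟨ ℚᵘ.*≤* (subst₂ ℤ._≤_ (ℤ.pos-* a _)
      (trans (ℤ.pos-* (b * suc l + c * suc j) (suc i)) (cong (ℤ._* + suc i)
        (cong₂ ℤ._+_ (ℤ.pos-* b (suc l)) (ℤ.pos-* c (suc j)))))
      (ℤ.+≤+ crossed)) ⟩
  mkℚᵘ (+ b) j ℚᵘ.+ mkℚᵘ (+ c) l ≃⟨ ℚᵘ.+-cong (toℚᵘ-/ b j) (toℚᵘ-/ c l) ⟨
  toℚᵘ (+ b / suc j) ℚᵘ.+ toℚᵘ (+ c / suc l) ≃⟨ ℚ.toℚᵘ-homo-+ (+ b / suc j) (+ c / suc l) ⟨
  toℚᵘ (+ b / suc j ℚ.+ + c / suc l) ∎)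
  where open ℚᵘ.≤-Reasoning

p≤q+r⇒p-r≤q : ∀ {p q} r → p ℚ.≤ q ℚ.+ r → p ℚ.- r ℚ.≤ q
p≤q+r⇒p-r≤q {p} {q} r p≤q+r = begin
  p ℚ.- r ≤⟨ ℚ.+-monoˡ-≤ (ℚ.- r) p≤q+r ⟩
  q ℚ.+ r ℚ.- r ≡⟨ ℚ.+-assoc q r (ℚ.- r) ⟩
  q ℚ.+ (r ℚ.- r) ≡⟨ cong (q ℚ.+_) (ℚ.+-inverseʳ r) ⟩
  q ℚ.+ 0ℚ ≡⟨ ℚ.+-identityʳ q ⟩
  q ∎
  where open ℚ.≤-Reasoning

-- The Ramsey number and its bounds

ramseyNumber : ∀ k → ∃[ n ] IsRamseyNumber 3 (Berge K₃) (suc k) n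
ramseyNumber k = least (arrows? k) (arrows-upper k)

-- The value at zero colours is a default outside the range of the theorem, chosen so that the
-- estimates below hold there too.
R : ℕ → ℕ
R zero    = 0
R (suc k) = proj₁ (ramseyNumber k)

R-isRamseyNumber : ∀ k → 2 ≤ k → IsRamseyNumber 3 (Berge K₃) k (R k)
R-isRamseyNumber (suc k) _ = proj₂ (ramseyNumber k)

4R≤3k+20 : ∀ k → 4 * R k ≤ 3 * k + 20
4R≤3k+20 zero    = z≤n
4R≤3k+20 k@(suc k′) = begin
  4 * R k ≤⟨ ℕ.*-monoʳ-≤ 4 (proj₂ (proj₂ (ramseyNumber k′)) _ (arrows-upper k′)) ⟩
  4 * (3 * k ℕ./ 4 + 5) ≡⟨ solve 1 (λ u → con 4 :* (u :+ con 5) := u :* con 4 :+ con 20) refl (3 * k ℕ./ 4) ⟩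
  3 * k ℕ./ 4 * 4 + 20 ≤⟨ ℕ.+-monoˡ-≤ 20 (m/n*n≤m (3 * k) 4) ⟩
  3 * k + 20 ∎
  where open ℕ.≤-Reasoning

-- The upper bound enters the lower one here: it limits the number of halvings of `R k` vertices in
-- terms of `k`.
R≤2^log : ∀ k → R k ≤ 2 ^ log k
R≤2^log k = ℕ.≤-trans (ℕ.*-cancelˡ-≤ 4 (begin
  4 * R k ≤⟨ 4R≤3k+20 k ⟩
  3 * k + 20 ≤⟨ ℕ.m≤m+n _ k ⟩
  3 * k + 20 + k ≡⟨ solve 1 (λ k → con 3 :* k :+ con 20 :+ k := con 4 :* (con 1 :+ (k :+ con 4))) refl k ⟩
  4 * suc (k + 4) ∎)) (proj₁ (proj₂ (ceil-log (k + 4))))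
  where open ℕ.≤-Reasoning

k≤2R+3log : ∀ k → k ≤ 2 * R k + 3 * log k
k≤2R+3log zero    = z≤n
k≤2R+3log (suc k) = arrows-lower (log (suc k)) (R≤2^log (suc k)) (proj₁ (proj₂ (ramseyNumber k)))

theorem1 : Σ[ R ∈ (ℕ → ℕ) ]
    ( (∀ k → 2 ℕ.≤ k → IsRamseyNumber 3 (Berge K₃) k (R k))
    × Σ[ f ∈ (ℕ → ℚ) ] Σ[ g ∈ (ℕ → ℚ) ]
    ( LittleO f
    × LittleO g
    × (∀ k → 2 ℕ.≤ k →
    ((+ k / 2) ℚ.- f k ℚ.≤ (+ R k / 1))
    × ((+ R k / 1) ℚ.≤ (+ (3 ℕ.* k) / 4) ℚ.+ g k)) ) )
theorem1 =
  R , R-isRamseyNumber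
  -- Halving `k ≤ 2 * R k + 3 * log k` leaves the error `3 * log k / 2`; twice that keeps the term
  -- integral. The 5 is `20 / 4` from `4R≤3k+20`.
  , (λ k → + (3 * log k) / 1) , (λ _ → + 5 / 1)
  , littleO (λ k → 3 * log k) log-sublinear
  , littleO (λ _ → 5) (λ q → 5 * suc q , λ _ N≤k → N≤k)
  , λ k _ → p≤q+r⇒p-r≤q (+ (3 * log k) / 1) (/-≤-+ {k} {R k} {3 * log k} (lower k))
        , /-≤-+ {R k} {3 * k} {5} (upper k)
  where
  open ℕ.≤-Reasoning
  lower : ∀ k → k * (1 * 1) ≤ (R k * 1 + 3 * log k * 1) * 2
  lower k = begin
    k * 1 ≡⟨ ℕ.*-identityʳ k ⟩
    k ≤⟨ k≤2R+3log k ⟩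
    2 * R k + 3 * log k ≤⟨ ℕ.m≤m+n _ (3 * log k) ⟩
    2 * R k + 3 * log k + 3 * log k
      ≡⟨ solve 2 (λ R d → con 2 :* R :+ con 3 :* d :+ con 3 :* d
                       := (R :* con 1 :+ con 3 :* d :* con 1) :* con 2) refl (R k) (log k) ⟩
    (R k * 1 + 3 * log k * 1) * 2 ∎
  upper : ∀ k → R k * (4 * 1) ≤ (3 * k * 1 + 5 * 4) * 1
  upper k = begin
    R k * 4 ≡⟨ ℕ.*-comm (R k) 4 ⟩
    4 * R k ≤⟨ 4R≤3k+20 k ⟩
    3 * k + 20 ≡⟨ solve 1 (λ k → con 3 :* k :+ con 20 := (con 3 :* k :* con 1 :+ con 20) :* con 1) refl k ⟩
    (3 * k * 1 + 5 * 4) * 1 ∎
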